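{- Let $p$ be a prime and consider the recurrence $\tau_{n+5}\tau_n=\tau_{n+4}\tau_{n+1}+\tau_{n+3}\tau_{n+2}$ with an initial value problem that is well-balanced mod $p$. Then the rational Somos-5 sequence $(\tau_n)_{n\in\mathbb{Z}}$ determined by these initial values is defined for all $n\in\mathbb{Z}$, and so is the reduced sequence $(\tau_n \bmod p)_{n\in\mathbb{Z}}$ (that is, every $\tau_n$ is a $p$-adic integer, $|\tau_n|_p\le1$); moreover the sequence $(\tau_n \bmod p)$ is periodic in $n$.
   Context: Definition (well-balanced): for a prime $p$, an initial value problem for $\tau_{n+5}\tau_n=\tau_{n+4}\tau_{n+1}+\tau_{n+3}\tau_{n+2}$ over $\mathbb{Q}$ is well-balanced mod $p$ if it is specified by either $(\tau_0,\tau_1,\tau_2,\tau_3,\tau_4)\in\mathbb{Q}^5$ or $(\tau_1,\tau_2,\tau_3,\tau_4,\tau_5)\in\mathbb{Q}^5$ such that $|\tau_1|_p=|\tau_2|_p=|\tau_3|_p=|\tau_4|_p=1$ and $|\tau_4\tau_1+\tau_3\tau_2|_p\le|\tau_*|_p\le1$ with $\tau_*\neq0$, where $\tau_*=\tau_0$ or $\tau_5$ accordingly; $|\cdot|_p$ is the $p$-adic absolute value. The recurrence has the Laurent property: for each $m\in\mathbb{Z}$ the term $\tau_{m}$ is given by a Laurent polynomial with integer coefficients in any five consecutive terms; the sequence determined by five nonzero initial values is understood as the values of these Laurent polynomials evaluated at the initial values (this continues the sequence past any zero terms), and this sequence satisfies the recurrence for all $n$. -}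

module Defs where

open import Data.Nat as ℕ using (ℕ; zero; suc)
open import Data.Nat.Divisibility using (_∣_)
open import Data.Integer as ℤ using (ℤ; +_; -[1+_])
open import Data.Integer.Properties as ℤP using ()
open import Data.Rational as ℚ using (ℚ; 0ℚ; 1ℚ; 1/_; ≢-nonZero)
open import Data.Rational.Properties as ℚP using ()
open import Data.Fin using (Fin; toℕ)
open import Data.Vec as Vec using (Vec; []; _∷_; lookup; zipWith; replicate; updateAt)
open import Data.Vec.Properties as VecP using ()
open import Data.List as List using (List; []; _∷_; _++_; concatMap; map; foldr)
open import Data.Product using (_×_; _,_; proj₁; proj₂)
open import Relation.Nullary using (¬_; yes; no)
open import Relation.Binary.PropositionalEquality using (_≡_)

-- Laurent polynomials over ℤ in 5 variables x₀,…,x₄, represented as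
-- finite lists of monomials (exponent vector in ℤ⁵, integer coefficient).
-- Two representations denote the same Laurent polynomial iff all their
-- coefficients agree (_≈L_ below).

Monomial : Set
Monomial = Vec ℤ 5 × ℤ

LPoly : Set
LPoly = List Monomial

var : Fin 5 → LPoly
var i = (updateAt (replicate 5 (+ 0)) i (λ _ → + 1) , + 1) ∷ []

_+L_ : LPoly → LPoly → LPoly
P +L Q = P ++ Q

_*L_ : LPoly → LPoly → LPoly
P *L Q = concatMap (λ m → map (λ n → (zipWith ℤ._+_ (proj₁ m) (proj₁ n) , proj₂ m ℤ.* proj₂ n)) Q) P

coeff : LPoly → Vec ℤ 5 → ℤ
coeff [] e = + 0
coeff ((e' , c) ∷ P) e with VecP.≡-dec ℤP._≟_ e' e
... | yes _ = c ℤ.+ coeff P e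
... | no  _ = coeff P e

_≈L_ : LPoly → LPoly → Set
P ≈L Q = ∀ e → coeff P e ≡ coeff Q e

-- Evaluation in ℚ.  The inverse is made total (inv 0 = 0); it is only
-- ever applied to the (nonzero) initial values.

inv : ℚ → ℚ
inv q with q ℚP.≟ 0ℚ
... | yes _ = 0ℚ
... | no q≢0 = 1/_ q {{≢-nonZero q≢0}}

powℕ : ℚ → ℕ → ℚ
powℕ q zero = 1ℚ
powℕ q (suc n) = q ℚ.* powℕ q n

powℤ : ℚ → ℤ → ℚ
powℤ q (+ n) = powℕ q n
powℤ q -[1+ n ] = powℕ (inv q) (suc n)

evalMono : ∀ {k} → Vec ℚ k → Vec ℤ k → ℚ
evalMono [] [] = 1ℚ
evalMono (q ∷ qs) (k ∷ ks) = powℤ q k ℚ.* evalMono qs ks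

eval : Vec ℚ 5 → LPoly → ℚ
eval v P = foldr (λ m acc → (ℚ._/ 1) (proj₂ m) ℚ.* evalMono v (proj₁ m) ℚ.+ acc) 0ℚ P

-- The Somos-5 Laurent polynomials, with the five variables placed at
-- indices s, s+1, …, s+4.  (Such a family exists by the Laurent property
-- and is unique since the Laurent ring is an integral domain.)

record Somos5Laurent (s : ℤ) (L : ℤ → LPoly) : Set where
  field
    initial : ∀ (i : Fin 5) → L (s ℤ.+ + toℕ i) ≈L var i
    recur   : ∀ (n : ℤ) →
      (L (n ℤ.+ + 5) *L L n) ≈L ((L (n ℤ.+ + 4) *L L (n ℤ.+ + 1)) +L (L (n ℤ.+ + 3) *L L (n ℤ.+ + 2)))

-- p-adic notions on ℚ (ℚ values are in lowest terms).

PInt : ℕ → ℚ → Set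
PInt p q = ¬ (p ∣ ℚ.denominatorℕ q)

PUnit : ℕ → ℚ → Set
PUnit p q = ¬ (p ∣ ℤ.∣ ℚ.numerator q ∣) × ¬ (p ∣ ℚ.denominatorℕ q)

-- |a|_p ≤ |b|_p, for b ≠ 0 (i.e. |a/b|_p ≤ 1)
AbsLe : ℕ → ℚ → ℚ → Set
AbsLe p a b = PInt p (a ℚ.* inv b)

-- a ≡ b (mod p) for p-integral a, b: |a - b|_p < 1
CongModP : ℕ → ℚ → ℚ → Set
CongModP p a b = p ∣ ℤ.∣ ℚ.numerator (a ℚ.- b) ∣

-- Well-balanced initial data.  s = 0: data (τ₀,…,τ₄), τ* = τ₀;
-- s = 1: data (τ₁,…,τ₅), τ* = τ₅.  In both cases v lists the data in
-- index order, so τ₁,…,τ₄ and τ* are read off from v as below.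

data Start : Set where
  start0 start1 : Start

startIdx : Start → ℤ
startIdx start0 = + 0
startIdx start1 = + 1

WellBalanced : ℕ → Start → Vec ℚ 5 → Set
WellBalanced p start0 (t0 ∷ t1 ∷ t2 ∷ t3 ∷ t4 ∷ []) =
  PUnit p t1 × PUnit p t2 × PUnit p t3 × PUnit p t4 ×
  ¬ (t0 ≡ 0ℚ) × AbsLe p (t4 ℚ.* t1 ℚ.+ t3 ℚ.* t2) t0 × PInt p t0
WellBalanced p start1 (t1 ∷ t2 ∷ t3 ∷ t4 ∷ t5 ∷ []) =
  PUnit p t1 × PUnit p t2 × PUnit p t3 × PUnit p t4 ×
  ¬ (t5 ≡ 0ℚ) × AbsLe p (t4 ℚ.* t1 ℚ.+ t3 ℚ.* t2) t5 × PInt p t5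

{-# OPTIONS --safe #-}

-- A Somos-5 sequence also satisfies the Somos-7 relation
--   τₙ₊₇ τₙ + τₙ₊₅ τₙ₊₂ = K τₙ₊₄ τₙ₊₃
-- with K independent of n.  The relation is proved for the Laurent polynomials themselves: they form
-- an integral domain in which no τₙ vanishes (all τₙ are positive at (1,1,1,1,1)), so that the factors
-- τₙ may be cancelled, and the relation survives specialisation even when some τₙ specialises to 0.
-- For well-balanced data K is a p-adic integer, and Somos-5 shows that no two of three consecutive
-- terms are divisible by p.  Hence seven consecutive terms determine the next one, and its residue:
-- by Somos-5 if τₙ₊₂ is a unit, by Somos-7 if τₙ is; likewise backwards.  This gives integrality, and
-- periodicity follows from the pigeonhole principle applied to windows of seven residues.
module Submission where

open import Defs
open import Algebra.Bundles using (CommutativeSemiring)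
import Algebra.Solver.Ring.NaturalCoefficients.Default as SemiringSolver
open import Algebra.Structures.Biased using (isCommutativeSemiringˡ)
open import Data.Fin as Fin using (Fin; zero; suc; toℕ; fromℕ<; combine; funToFin; finToFun; #_)
import Data.Fin.Properties as FinP
open import Data.Integer as ℤ using (ℤ; +_; -[1+_])
open import Data.Integer.DivMod using (n%ℕd<d; a≡a%ℕn+[a/ℕn]*n)
import Data.Integer.Divisibility.Signed as Signed
import Data.Integer.Properties as ℤP
open import Data.Integer.Solver using () renaming (module +-*-Solver to ℤ-Solver)
open import Data.List using ([]; _∷_; _++_; map; foldr; filter; length)
import Data.List.Properties as ListP
open import Data.List.Relation.Unary.All as All using (All; []; _∷_)
import Data.List.Relation.Unary.All.Properties as AllP
open import Data.List.Relation.Unary.Any as Any using (Any; here; there)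
open import Data.Nat as ℕ using (ℕ; zero; suc; _≥_)
import Data.Nat.Coprimality as Coprime
open import Data.Nat.Divisibility using (_∣_; _∣?_; _∣0)
open import Data.Nat.Induction using (<-rec)
open import Data.Nat.Primality using (Prime; euclidsLemma; prime⇒nonZero; prime⇒nonTrivial)
import Data.Nat.Properties as ℕP
open import Data.Product as Prod using (_×_; _,_; proj₁; proj₂; Σ; ∃; ∃₂)
open import Data.Rational as ℚ using (ℚ; 0ℚ; 1ℚ; mkℚ; ↥_; ↧_; ↧ₙ_)
import Data.Rational.Properties as ℚP
open import Data.Rational.Solver using () renaming (module +-*-Solver to ℚ-Solver)
import Data.Rational.Unnormalised as ℚᵘ
import Data.Rational.Unnormalised.Properties as ℚᵘP
open import Data.Sum as Sum using (_⊎_; inj₁; inj₂)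
open import Data.Vec using (Vec; []; _∷_; zipWith; replicate; lookup)
import Data.Vec.Properties as VecP
open import Data.Vec.Relation.Unary.All as VecAll using ([]; _∷_)
open import Level using (0ℓ)
open import Relation.Binary using (IsEquivalence; tri<; tri≈; tri>)
open import Relation.Binary.PropositionalEquality as ≡ using (_≡_; _≢_; refl; cong; cong₂; subst)
open import Relation.Nullary using (¬_; Dec; yes; no; ¬?; contradiction)
open import Relation.Nullary.Decidable using (True; toWitness)

-- Somos-5 yields `τₙ₊₅` only after a division by `τₙ`, so as soon as `p` divides `τₙ` the residues
-- seen so far say nothing about the next one. Somos-7 is brought in to supply a second divisor for
-- the same unknown. The constant K is kept as a fraction N/D with D = τ₁τ₂τ₃τ₄, the product of the
-- four units of the data, while N is a polynomial in τ₀, ..., τ₅. Well-balanced data prescribe only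
-- one of the outer terms τ₀ and τ₅. Since τ₅τ₀ = τ₄τ₁ + τ₃τ₂, the inequality in the definition says
-- precisely that the other one is a p-adic integer too; so N is integral, D is a unit, and the
-- window from τ₀ onwards is a legitimate start for the propagation in both directions.

ℤ-induction : ∀ {ℓ} (P : ℤ → Set ℓ) → P (+ 0) →
  (∀ n → P n → P (n ℤ.+ + 1)) → (∀ n → P (n ℤ.+ + 1) → P n) → ∀ n → P n
ℤ-induction P base up down (+ zero) = base
ℤ-induction P base up down (+ suc n) =
  ≡.subst P (≡.cong +_ (ℕP.+-comm n 1)) (up (+ n) (ℤ-induction P base up down (+ n)))
ℤ-induction P base up down -[1+ zero ] = down -[1+ zero ] base
ℤ-induction P base up down -[1+ suc n ] = down -[1+ suc n ] (ℤ-induction P base up down -[1+ n ])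

n+1+k : ∀ n k → (n ℤ.+ + 1) ℤ.+ + k ≡ n ℤ.+ + suc k
n+1+k n k = ℤP.+-assoc n (+ 1) (+ k)

ℤ-induction-from : ∀ {ℓ} (P : ℤ → Set ℓ) s → P s →
  (∀ n → P n → P (n ℤ.+ + 1)) → (∀ n → P (n ℤ.+ + 1) → P n) → ∀ n → P n
ℤ-induction-from P s base up down n = subst P s+[n-s]≡n (ℤ-induction (λ k → P (s ℤ.+ k))
  (subst P (≡.sym (ℤP.+-identityʳ s)) base)
  (λ k x → subst P (ℤP.+-assoc s k (+ 1)) (up (s ℤ.+ k) x))
  (λ k x → down (s ℤ.+ k) (subst P (≡.sym (ℤP.+-assoc s k (+ 1))) x))
  (n ℤ.- s))
  where
  s+[n-s]≡n : s ℤ.+ (n ℤ.- s) ≡ n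
  s+[n-s]≡n = ≡.trans (ℤP.+-comm s (n ℤ.- s)) (≡.trans (ℤP.+-assoc n (ℤ.- s) s)
    (≡.trans (cong (λ z → n ℤ.+ z) (ℤP.+-inverseˡ s)) (ℤP.+-identityʳ n)))

-- Somos-5 implies Somos-7

module Somos7 {c ℓ} (R : CommutativeSemiring c ℓ) where
  open CommutativeSemiring R hiding (refl)
  private module R = CommutativeSemiring R
  open import Relation.Binary.Reasoning.Setoid setoid
  open SemiringSolver R using (Polynomial; solve; _:+_; _:*_; _:=_)

  -- With hₙ = τₙ₊₂ τₙ₋₁ / (τₙ₊₁ τₙ) the recurrence reads hₙ₊₁ hₙ₋₁ = 1 + 1/hₙ, a QRT map with invariant
  -- hₙ₋₁ + hₙ + hₙ₊₁ + 1/hₙ.  The constant K is this invariant plus 2, and num / den is K written in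
  -- six consecutive terms; the lemmas are stated without division.
  den : (t₁ t₂ t₃ t₄ : Carrier) → Carrier
  den t₁ t₂ t₃ t₄ = t₁ * t₂ * t₃ * t₄

  num : (t₀ t₁ t₂ t₃ t₄ t₅ : Carrier) → Carrier
  num t₀ t₁ t₂ t₃ t₄ t₅ =
    t₃ * t₃ * t₀ * t₄ + t₄ * t₄ * t₁ * t₁ + t₅ * t₂ * t₂ * t₁ + t₃ * t₃ * t₂ * t₂
    + (den t₁ t₂ t₃ t₄ + den t₁ t₂ t₃ t₄)

  private
    :den : ∀ {n} (t₁ t₂ t₃ t₄ : Polynomial n) → Polynomial n
    :den t₁ t₂ t₃ t₄ = t₁ :* t₂ :* t₃ :* t₄

    :num : ∀ {n} (t₀ t₁ t₂ t₃ t₄ t₅ : Polynomial n) → Polynomial n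
    :num t₀ t₁ t₂ t₃ t₄ t₅ =
      t₃ :* t₃ :* t₀ :* t₄ :+ t₄ :* t₄ :* t₁ :* t₁ :+ t₅ :* t₂ :* t₂ :* t₁ :+ t₃ :* t₃ :* t₂ :* t₂
      :+ (:den t₁ t₂ t₃ t₄ :+ :den t₁ t₂ t₃ t₄)

  -- Only one monomial of the left `num` contains `t₆`, and there the factor `t₁` completes it to
  -- `t₆ * t₁`; the second relation removes it. The first relation, read backwards, then creates the
  -- monomial with `t₀`. As `den` shifts by the same factors, `num / den` is invariant.
  num-shift : ∀ {t₀ t₁ t₂ t₃ t₄ t₅ t₆} →
    t₅ * t₀ ≈ t₄ * t₁ + t₃ * t₂ → t₆ * t₁ ≈ t₅ * t₂ + t₄ * t₃ →
    num t₁ t₂ t₃ t₄ t₅ t₆ * t₁ ≈ num t₀ t₁ t₂ t₃ t₄ t₅ * t₅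
  num-shift {t₀} {t₁} {t₂} {t₃} {t₄} {t₅} {t₆} r₀ r₁ = begin
    num t₁ t₂ t₃ t₄ t₅ t₆ * t₁
      ≈⟨ solve 6 (λ t₁ t₂ t₃ t₄ t₅ t₆ →
        :num t₁ t₂ t₃ t₄ t₅ t₆ :* t₁
        := t₃ :* t₃ :* t₂ :* (t₆ :* t₁)
           :+ t₁ :* (t₄ :* t₄ :* t₁ :* t₅ :+ t₅ :* t₅ :* t₂ :* t₂ :+ t₄ :* t₄ :* t₃ :* t₃
             :+ (:den t₂ t₃ t₄ t₅ :+ :den t₂ t₃ t₄ t₅)))
        R.refl t₁ t₂ t₃ t₄ t₅ t₆ ⟩
    t₃ * t₃ * t₂ * (t₆ * t₁)
      + t₁ * (t₄ * t₄ * t₁ * t₅ + t₅ * t₅ * t₂ * t₂ + t₄ * t₄ * t₃ * t₃ + (den t₂ t₃ t₄ t₅ + den t₂ t₃ t₄ t₅))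
      ≈⟨ +-congʳ (*-congˡ r₁) ⟩
    t₃ * t₃ * t₂ * (t₅ * t₂ + t₄ * t₃)
      + t₁ * (t₄ * t₄ * t₁ * t₅ + t₅ * t₅ * t₂ * t₂ + t₄ * t₄ * t₃ * t₃ + (den t₂ t₃ t₄ t₅ + den t₂ t₃ t₄ t₅))
      ≈⟨ solve 5 (λ t₁ t₂ t₃ t₄ t₅ →
        t₃ :* t₃ :* t₂ :* (t₅ :* t₂ :+ t₄ :* t₃)
           :+ t₁ :* (t₄ :* t₄ :* t₁ :* t₅ :+ t₅ :* t₅ :* t₂ :* t₂ :+ t₄ :* t₄ :* t₃ :* t₃
             :+ (:den t₂ t₃ t₄ t₅ :+ :den t₂ t₃ t₄ t₅))
        := t₃ :* t₃ :* t₄ :* (t₄ :* t₁ :+ t₃ :* t₂)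
           :+ t₅ :* (t₄ :* t₄ :* t₁ :* t₁ :+ t₅ :* t₂ :* t₂ :* t₁ :+ t₃ :* t₃ :* t₂ :* t₂
             :+ (:den t₁ t₂ t₃ t₄ :+ :den t₁ t₂ t₃ t₄)))
        R.refl t₁ t₂ t₃ t₄ t₅ ⟩
    t₃ * t₃ * t₄ * (t₄ * t₁ + t₃ * t₂)
      + t₅ * (t₄ * t₄ * t₁ * t₁ + t₅ * t₂ * t₂ * t₁ + t₃ * t₃ * t₂ * t₂ + (den t₁ t₂ t₃ t₄ + den t₁ t₂ t₃ t₄))
      ≈⟨ +-congʳ (*-congˡ r₀) ⟨
    t₃ * t₃ * t₄ * (t₅ * t₀)
      + t₅ * (t₄ * t₄ * t₁ * t₁ + t₅ * t₂ * t₂ * t₁ + t₃ * t₃ * t₂ * t₂ + (den t₁ t₂ t₃ t₄ + den t₁ t₂ t₃ t₄))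
      ≈⟨ solve 6 (λ t₀ t₁ t₂ t₃ t₄ t₅ →
        t₃ :* t₃ :* t₄ :* (t₅ :* t₀)
           :+ t₅ :* (t₄ :* t₄ :* t₁ :* t₁ :+ t₅ :* t₂ :* t₂ :* t₁ :+ t₃ :* t₃ :* t₂ :* t₂
             :+ (:den t₁ t₂ t₃ t₄ :+ :den t₁ t₂ t₃ t₄))
        := :num t₀ t₁ t₂ t₃ t₄ t₅ :* t₅)
        R.refl t₀ t₁ t₂ t₃ t₄ t₅ ⟩
    num t₀ t₁ t₂ t₃ t₄ t₅ * t₅ ∎

  -- The factors `t₂` and `t₅` of `den` turn `t₇ * t₀` into a product of two left-hand sides of
  -- Somos-5. Expanding the right-hand sides produces `t₆ * t₁`, to which the middle relation
  -- applies. K is read off the window `t₁`, ..., `t₆`, which lies symmetrically inside `t₀`, ...,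
  -- `t₇`.
  num-somos7 : ∀ {t₀ t₁ t₂ t₃ t₄ t₅ t₆ t₇} →
    t₅ * t₀ ≈ t₄ * t₁ + t₃ * t₂ → t₆ * t₁ ≈ t₅ * t₂ + t₄ * t₃ → t₇ * t₂ ≈ t₆ * t₃ + t₅ * t₄ →
    den t₂ t₃ t₄ t₅ * (t₇ * t₀ + t₅ * t₂) ≈ num t₁ t₂ t₃ t₄ t₅ t₆ * (t₄ * t₃)
  num-somos7 {t₀} {t₁} {t₂} {t₃} {t₄} {t₅} {t₆} {t₇} r₀ r₁ r₂ = begin
    den t₂ t₃ t₄ t₅ * (t₇ * t₀ + t₅ * t₂)
      ≈⟨ solve 6 (λ t₀ t₂ t₃ t₄ t₅ t₇ →
        :den t₂ t₃ t₄ t₅ :* (t₇ :* t₀ :+ t₅ :* t₂)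
        := t₃ :* t₄ :* ((t₇ :* t₂) :* (t₅ :* t₀) :+ t₅ :* t₅ :* t₂ :* t₂))
        R.refl t₀ t₂ t₃ t₄ t₅ t₇ ⟩
    t₃ * t₄ * ((t₇ * t₂) * (t₅ * t₀) + t₅ * t₅ * t₂ * t₂)
      ≈⟨ *-congˡ (+-congʳ (*-cong r₂ r₀)) ⟩
    t₃ * t₄ * ((t₆ * t₃ + t₅ * t₄) * (t₄ * t₁ + t₃ * t₂) + t₅ * t₅ * t₂ * t₂)
      ≈⟨ solve 6 (λ t₁ t₂ t₃ t₄ t₅ t₆ →
        t₃ :* t₄ :* ((t₆ :* t₃ :+ t₅ :* t₄) :* (t₄ :* t₁ :+ t₃ :* t₂) :+ t₅ :* t₅ :* t₂ :* t₂)
        := t₃ :* t₄ :* (t₃ :* t₄ :* (t₆ :* t₁)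
           :+ (t₆ :* t₃ :* t₃ :* t₂ :+ t₅ :* t₄ :* t₄ :* t₁ :+ t₅ :* t₄ :* t₃ :* t₂ :+ t₅ :* t₅ :* t₂ :* t₂)))
        R.refl t₁ t₂ t₃ t₄ t₅ t₆ ⟩
    t₃ * t₄ * (t₃ * t₄ * (t₆ * t₁)
      + (t₆ * t₃ * t₃ * t₂ + t₅ * t₄ * t₄ * t₁ + t₅ * t₄ * t₃ * t₂ + t₅ * t₅ * t₂ * t₂))
      ≈⟨ *-congˡ (+-congʳ (*-congˡ r₁)) ⟩
    t₃ * t₄ * (t₃ * t₄ * (t₅ * t₂ + t₄ * t₃)
      + (t₆ * t₃ * t₃ * t₂ + t₅ * t₄ * t₄ * t₁ + t₅ * t₄ * t₃ * t₂ + t₅ * t₅ * t₂ * t₂))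
      ≈⟨ solve 6 (λ t₁ t₂ t₃ t₄ t₅ t₆ →
        t₃ :* t₄ :* (t₃ :* t₄ :* (t₅ :* t₂ :+ t₄ :* t₃)
           :+ (t₆ :* t₃ :* t₃ :* t₂ :+ t₅ :* t₄ :* t₄ :* t₁ :+ t₅ :* t₄ :* t₃ :* t₂ :+ t₅ :* t₅ :* t₂ :* t₂))
        := :num t₁ t₂ t₃ t₄ t₅ t₆ :* (t₄ :* t₃))
        R.refl t₁ t₂ t₃ t₄ t₅ t₆ ⟩
    num t₁ t₂ t₃ t₄ t₅ t₆ * (t₄ * t₃) ∎

  module _ (a : ℤ → Carrier)
    (somos5 : ∀ n → a (n ℤ.+ + 5) * a n
                  ≈ a (n ℤ.+ + 4) * a (n ℤ.+ + 1) + a (n ℤ.+ + 3) * a (n ℤ.+ + 2))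
    (cancel : ∀ n x y → a n * x ≈ a n * y → x ≈ y) where

    denAt numAt : ℤ → Carrier
    denAt n = den (a (n ℤ.+ + 1)) (a (n ℤ.+ + 2)) (a (n ℤ.+ + 3)) (a (n ℤ.+ + 4))
    numAt n = num (a n) (a (n ℤ.+ + 1)) (a (n ℤ.+ + 2)) (a (n ℤ.+ + 3)) (a (n ℤ.+ + 4)) (a (n ℤ.+ + 5))

    private
      b : ℤ → ℕ → Carrier
      b n k = a (n ℤ.+ + k)

      somos5₁ : ∀ n → b n 6 * b n 1 ≈ b n 5 * b n 2 + b n 4 * b n 3
      somos5₁ n with r ← somos5 (n ℤ.+ + 1)
        rewrite n+1+k n 5 | n+1+k n 4 | n+1+k n 3 | n+1+k n 2 | n+1+k n 1 = r

      somos5₂ : ∀ n → b n 7 * b n 2 ≈ b n 6 * b n 3 + b n 5 * b n 4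
      somos5₂ n with r ← somos5₁ (n ℤ.+ + 1)
        rewrite n+1+k n 6 | n+1+k n 5 | n+1+k n 4 | n+1+k n 3 | n+1+k n 2 | n+1+k n 1 = r

      numAt-suc : ∀ n → numAt (n ℤ.+ + 1) ≡ num (b n 1) (b n 2) (b n 3) (b n 4) (b n 5) (b n 6)
      numAt-suc n
        rewrite n+1+k n 5 | n+1+k n 4 | n+1+k n 3 | n+1+k n 2 | n+1+k n 1 = ≡.refl

      denAt-suc : ∀ n → denAt (n ℤ.+ + 1) ≡ den (b n 2) (b n 3) (b n 4) (b n 5)
      denAt-suc n
        rewrite n+1+k n 4 | n+1+k n 3 | n+1+k n 2 | n+1+k n 1 = ≡.refl

      numAt-shift : ∀ n → numAt (n ℤ.+ + 1) * b n 1 ≈ numAt n * b n 5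
      numAt-shift n = trans (*-congʳ (reflexive (numAt-suc n))) (num-shift (somos5 n) (somos5₁ n))

      denAt-shift : ∀ n → denAt (n ℤ.+ + 1) * b n 1 ≈ denAt n * b n 5
      denAt-shift n = trans (*-congʳ (reflexive (denAt-suc n)))
        (solve 5 (λ t₁ t₂ t₃ t₄ t₅ → t₂ :* t₃ :* t₄ :* t₅ :* t₁ := t₁ :* t₂ :* t₃ :* t₄ :* t₅) R.refl
           (b n 1) (b n 2) (b n 3) (b n 4) (b n 5))

      exchange : ∀ {x x′ y y′ u v p q} → x′ * u ≈ x * v → y′ * u ≈ y * v →
        p * x ≈ q * y → u * (p * x′) ≈ u * (q * y′)
      exchange {x} {x′} {y} {y′} {u} {v} {p} {q} ex ey e = begin
        u * (p * x′)  ≈⟨ rotate u p x′ ⟩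
        p * (x′ * u)  ≈⟨ *-congˡ ex ⟩
        p * (x * v)   ≈⟨ *-assoc p x v ⟨
        p * x * v     ≈⟨ *-congʳ e ⟩
        q * y * v     ≈⟨ *-assoc q y v ⟩
        q * (y * v)   ≈⟨ *-congˡ ey ⟨
        q * (y′ * u)  ≈⟨ rotate u q y′ ⟨
        u * (q * y′)  ∎
        where
        rotate : ∀ u p x → u * (p * x) ≈ p * (x * u)
        rotate = solve 3 (λ u p x → u :* (p :* x) := p :* (x :* u)) R.refl

    -- Under a shift both sequences are multiplied by the same ratio τₙ₊₅/τₙ₊₁. Without division,
    -- the step upwards costs a cancellation of τₙ₊₁ and the step downwards one of τₙ₊₅.
    numAt/denAt-constant : ∀ n → denAt (+ 0) * numAt n ≈ numAt (+ 0) * denAt n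
    numAt/denAt-constant = ℤ-induction _ (*-comm _ _)
      (λ n e → cancel (n ℤ.+ + 1) _ _ (exchange (numAt-shift n) (denAt-shift n) e))
      (λ n e → cancel (n ℤ.+ + 5) _ _ (exchange (sym (numAt-shift n)) (sym (denAt-shift n)) e))

    somos7 : ∀ n → denAt (+ 0) * (a (n ℤ.+ + 7) * a n + a (n ℤ.+ + 5) * a (n ℤ.+ + 2))
                 ≈ numAt (+ 0) * (a (n ℤ.+ + 4) * a (n ℤ.+ + 3))
    -- `num-somos7` carries the extra factor `D`, a product of four terms of the sequence. Only
    -- single terms can be cancelled, so `D` is peeled off factor by factor.
    somos7 n = cancel (n ℤ.+ + 2) _ _ (cancel (n ℤ.+ + 3) _ _ (cancel (n ℤ.+ + 4) _ _ (cancel (n ℤ.+ + 5) _ _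
      (trans (gather _ _ _ _ _) (trans scaled (sym (gather _ _ _ _ _)))))))
      where
      X Y D N D₀ N₀ : Carrier
      X = b n 7 * a n + b n 5 * b n 2
      Y = b n 4 * b n 3
      D = den (b n 2) (b n 3) (b n 4) (b n 5)
      N = num (b n 1) (b n 2) (b n 3) (b n 4) (b n 5) (b n 6)
      D₀ = denAt (+ 0)
      N₀ = numAt (+ 0)
      gather : ∀ t₂ t₃ t₄ t₅ x → t₅ * (t₄ * (t₃ * (t₂ * x))) ≈ den t₂ t₃ t₄ t₅ * x
      gather = solve 5 (λ t₂ t₃ t₄ t₅ x → t₅ :* (t₄ :* (t₃ :* (t₂ :* x))) := :den t₂ t₃ t₄ t₅ :* x) R.refl
      constant : D₀ * N ≈ N₀ * D
      constant = begin
        D₀ * N                     ≡⟨ ≡.cong (D₀ *_) (numAt-suc n) ⟨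
        D₀ * numAt (n ℤ.+ + 1)     ≈⟨ numAt/denAt-constant (n ℤ.+ + 1) ⟩
        N₀ * denAt (n ℤ.+ + 1)     ≡⟨ ≡.cong (N₀ *_) (denAt-suc n) ⟩
        N₀ * D                     ∎
      scaled : D * (D₀ * X) ≈ D * (N₀ * Y)
      scaled = begin
        D * (D₀ * X)   ≈⟨ swap D D₀ X ⟩
        D₀ * (D * X)   ≈⟨ *-congˡ (num-somos7 (somos5 n) (somos5₁ n) (somos5₂ n)) ⟩
        D₀ * (N * Y)   ≈⟨ *-assoc D₀ N Y ⟨
        D₀ * N * Y     ≈⟨ *-congʳ constant ⟩
        N₀ * D * Y     ≈⟨ *-assoc N₀ D Y ⟩
        N₀ * (D * Y)   ≈⟨ swap D N₀ Y ⟨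
        D * (N₀ * Y)   ∎
        where
        swap : ∀ x y z → x * (y * z) ≈ y * (x * z)
        swap = solve 3 (λ x y z → x :* (y :* z) := y :* (x :* z)) R.refl

open ℚ-Solver using (solve; _:+_; _:*_; :-_; _:-_; _:=_; con)

-- Laurent polynomials

ι : ℤ → ℚ
ι z = z ℚ./ 1

private
  toℚᵘ-ι : ∀ z → ℚ.toℚᵘ (ι z) ℚᵘ.≃ ℚᵘ.mkℚᵘ z 0
  toℚᵘ-ι z = ℚP.toℚᵘ-fromℚᵘ (ℚᵘ.mkℚᵘ z 0)

ι-injective : ∀ {a b} → ι a ≡ ι b → a ≡ b
ι-injective {a} {b} e with ℚP.fromℚᵘ-injective {ℚᵘ.mkℚᵘ a 0} {ℚᵘ.mkℚᵘ b 0} e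
... | ℚᵘ.*≡* e′ = ≡.trans (≡.sym (ℤP.*-identityʳ a)) (≡.trans e′ (ℤP.*-identityʳ b))

ι-+ : ∀ a b → ι (a ℤ.+ b) ≡ ι a ℚ.+ ι b
ι-+ a b = ℚP.toℚᵘ-injective (begin
  ℚ.toℚᵘ (ι (a ℤ.+ b))                  ≈⟨ toℚᵘ-ι (a ℤ.+ b) ⟩
  ℚᵘ.mkℚᵘ (a ℤ.+ b) 0                   ≈⟨ ℚᵘ.*≡* (cong (ℤ._* + 1)
      (cong₂ ℤ._+_ (≡.sym (ℤP.*-identityʳ a)) (≡.sym (ℤP.*-identityʳ b)))) ⟩
  ℚᵘ.mkℚᵘ a 0 ℚᵘ.+ ℚᵘ.mkℚᵘ b 0          ≈⟨ ℚᵘP.+-cong (toℚᵘ-ι a) (toℚᵘ-ι b) ⟨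
  ℚ.toℚᵘ (ι a) ℚᵘ.+ ℚ.toℚᵘ (ι b)        ≈⟨ ℚP.toℚᵘ-homo-+ (ι a) (ι b) ⟨
  ℚ.toℚᵘ (ι a ℚ.+ ι b)                  ∎)
  where open import Relation.Binary.Reasoning.Setoid ℚᵘP.≃-setoid

ι-* : ∀ a b → ι (a ℤ.* b) ≡ ι a ℚ.* ι b
ι-* a b = ℚP.toℚᵘ-injective (begin
  ℚ.toℚᵘ (ι (a ℤ.* b))                  ≈⟨ toℚᵘ-ι (a ℤ.* b) ⟩
  ℚᵘ.mkℚᵘ a 0 ℚᵘ.* ℚᵘ.mkℚᵘ b 0          ≈⟨ ℚᵘP.*-cong (toℚᵘ-ι a) (toℚᵘ-ι b) ⟨
  ℚ.toℚᵘ (ι a) ℚᵘ.* ℚ.toℚᵘ (ι b)        ≈⟨ ℚP.toℚᵘ-homo-* (ι a) (ι b) ⟨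
  ℚ.toℚᵘ (ι a ℚ.* ι b)                  ∎)
  where open import Relation.Binary.Reasoning.Setoid ℚᵘP.≃-setoid

ι-neg : ∀ a → ι (ℤ.- a) ≡ ℚ.- ι a
ι-neg (+ zero)  = refl
ι-neg (+ suc n) = refl
ι-neg -[1+ n ]  = ≡.sym (neg-involutive (ι (+ suc n)))
  where
  neg-involutive : ∀ q → ℚ.- (ℚ.- q) ≡ q
  neg-involutive = solve 1 (λ q → :- (:- q) := q) refl

inv-inverseˡ : ∀ {q} → q ≢ 0ℚ → inv q ℚ.* q ≡ 1ℚ
inv-inverseˡ {q} q≢0 with q ℚP.≟ 0ℚ
... | yes q≡0 = contradiction q≡0 q≢0
... | no  q≢0′ = ℚP.*-inverseˡ q {{ℚ.≢-nonZero q≢0′}}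

*-cancelˡ-ℚ : ∀ x {y z} → x ≢ 0ℚ → x ℚ.* y ≡ x ℚ.* z → y ≡ z
*-cancelˡ-ℚ x {y} {z} x≢0 e = ≡.trans (≡.sym (undo y)) (≡.trans (cong (inv x ℚ.*_) e) (undo z))
  where
  undo : ∀ w → inv x ℚ.* (x ℚ.* w) ≡ w
  undo w = ≡.trans (≡.sym (ℚP.*-assoc (inv x) x w))
    (≡.trans (cong (ℚ._* w) (inv-inverseˡ x≢0)) (ℚP.*-identityˡ w))

xy≢0 : ∀ {x y} → x ≢ 0ℚ → y ≢ 0ℚ → x ℚ.* y ≢ 0ℚ
xy≢0 {x} x≢0 y≢0 xy≡0 = y≢0 (*-cancelˡ-ℚ x x≢0 (≡.trans xy≡0 (≡.sym (ℚP.*-zeroʳ x))))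

-- Linear functionals and equality of Laurent polynomials

Exp : Set
Exp = Vec ℤ 5

_≟ₑ_ : (d e : Exp) → Dec (d ≡ e)
_≟ₑ_ = VecP.≡-dec ℤP._≟_

infixl 6 _⊕_
_⊕_ : ∀ {k} → Vec ℤ k → Vec ℤ k → Vec ℤ k
_⊕_ = zipWith ℤ._+_

-- The ℚ-linear functional on Laurent polynomials taking the value φ e at the monomial xᵉ;
-- evaluation (φ = evalMono v) and coefficient extraction (φ = δ e) are both of this form.
ext : (Exp → ℚ) → LPoly → ℚ
ext φ P = foldr (λ m acc → ι (proj₂ m) ℚ.* φ (proj₁ m) ℚ.+ acc) 0ℚ P

δ : Exp → Exp → ℚ
δ e d with d ≟ₑ e
... | yes _ = 1ℚ
... | no  _ = 0ℚ

δ-refl : ∀ e → δ e e ≡ 1ℚ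
δ-refl e with e ≟ₑ e
... | yes _   = refl
... | no  e≢e = contradiction refl e≢e

δ-≢ : ∀ {d e} → d ≢ e → δ e d ≡ 0ℚ
δ-≢ {d} {e} d≢e with d ≟ₑ e
... | yes d≡e = contradiction d≡e d≢e
... | no  _   = refl

ext-δ : ∀ P e → ext (δ e) P ≡ ι (coeff P e)
ext-δ [] e = refl
ext-δ ((d , c) ∷ P) e with VecP.≡-dec ℤP._≟_ d e
... | yes _ = begin
  ι c ℚ.* 1ℚ ℚ.+ ext (δ e) P  ≡⟨ cong₂ ℚ._+_ (ℚP.*-identityʳ (ι c)) (ext-δ P e) ⟩
  ι c ℚ.+ ι (coeff P e)       ≡⟨ ι-+ c (coeff P e) ⟨
  ι (c ℤ.+ coeff P e)         ∎
  where open ≡.≡-Reasoning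
... | no _ = begin
  ι c ℚ.* 0ℚ ℚ.+ ext (δ e) P  ≡⟨ cong₂ ℚ._+_ (ℚP.*-zeroʳ (ι c)) (ext-δ P e) ⟩
  0ℚ ℚ.+ ι (coeff P e)        ≡⟨ ℚP.+-identityˡ _ ⟩
  ι (coeff P e)               ∎
  where open ≡.≡-Reasoning

ext-cong : ∀ {φ ψ} → (∀ e → φ e ≡ ψ e) → ∀ P → ext φ P ≡ ext ψ P
ext-cong φ≗ψ []            = refl
ext-cong φ≗ψ ((e , c) ∷ P) = cong₂ (λ x y → ι c ℚ.* x ℚ.+ y) (φ≗ψ e) (ext-cong φ≗ψ P)

ext-vanish : ∀ {φ P} → All (λ m → φ (proj₁ m) ≡ 0ℚ) P → ext φ P ≡ 0ℚ
ext-vanish [] = refl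
ext-vanish {φ} {(e , c) ∷ P} (φe≡0 ∷ φP≡0) rewrite φe≡0 | ext-vanish {φ} φP≡0 =
  cong (ℚ._+ 0ℚ) (ℚP.*-zeroʳ (ι c))

ext-++ : ∀ φ P Q → ext φ (P ++ Q) ≡ ext φ P ℚ.+ ext φ Q
ext-++ φ []            Q = ≡.sym (ℚP.+-identityˡ _)
ext-++ φ ((e , c) ∷ P) Q =
  ≡.trans (cong (ι c ℚ.* φ e ℚ.+_) (ext-++ φ P Q)) (≡.sym (ℚP.+-assoc (ι c ℚ.* φ e) _ _))

ext-+ : ∀ φ ψ P → ext (λ e → φ e ℚ.+ ψ e) P ≡ ext φ P ℚ.+ ext ψ P
ext-+ φ ψ []            = refl
ext-+ φ ψ ((e , c) ∷ P) = ≡.trans (cong (ι c ℚ.* (φ e ℚ.+ ψ e) ℚ.+_) (ext-+ φ ψ P))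
  (solve 5 (λ c x y p q → c :* (x :+ y) :+ (p :+ q) := c :* x :+ p :+ (c :* y :+ q)) refl
    (ι c) (φ e) (ψ e) (ext φ P) (ext ψ P))

ext-* : ∀ k φ P → ext (λ e → k ℚ.* φ e) P ≡ k ℚ.* ext φ P
ext-* k φ []            = ≡.sym (ℚP.*-zeroʳ k)
ext-* k φ ((e , c) ∷ P) = ≡.trans (cong (ι c ℚ.* (k ℚ.* φ e) ℚ.+_) (ext-* k φ P))
  (solve 4 (λ c k x p → c :* (k :* x) :+ k :* p := k :* (c :* x :+ p)) refl
    (ι c) k (φ e) (ext φ P))

-- Interchange of two finite sums; the commutativity of `_*L_` reduces to it.
ext-swap : ∀ (f : Exp → Exp → ℚ) P Q →
  ext (λ d → ext (f d) Q) P ≡ ext (λ e → ext (λ d → f d e) P) Q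
ext-swap f [] Q = ≡.sym (ext-vanish (All.universal (λ _ → refl) Q))
ext-swap f ((d , c) ∷ P) Q = begin
  ι c ℚ.* ext (f d) Q ℚ.+ ext (λ d → ext (f d) Q) P
    ≡⟨ cong₂ ℚ._+_ (≡.sym (ext-* (ι c) (f d) Q)) (ext-swap f P Q) ⟩
  ext (λ e → ι c ℚ.* f d e) Q ℚ.+ ext (λ e → ext (λ d → f d e) P) Q
    ≡⟨ ext-+ (λ e → ι c ℚ.* f d e) (λ e → ext (λ d → f d e) P) Q ⟨
  ext (λ e → ext (λ d → f d e) ((d , c) ∷ P)) Q ∎
  where open ≡.≡-Reasoning

ext-scale : ∀ φ e c Q →
  ext φ (map (λ n → (e ⊕ proj₁ n , c ℤ.* proj₂ n)) Q) ≡ ι c ℚ.* ext (λ d → φ (e ⊕ d)) Q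
ext-scale φ e c []            = ≡.sym (ℚP.*-zeroʳ (ι c))
ext-scale φ e c ((d , b) ∷ Q) = ≡.trans
  (cong₂ (λ x y → x ℚ.* φ (e ⊕ d) ℚ.+ y) (ι-* c b) (ext-scale φ e c Q))
  (solve 4 (λ c b x q → c :* b :* x :+ c :* q := c :* (b :* x :+ q)) refl
    (ι c) (ι b) (φ (e ⊕ d)) (ext (λ d → φ (e ⊕ d)) Q))

-- The product is a convolution, so a functional on it is an iterated sum. The laws of
-- multiplication, the absence of zero divisors and the multiplicativity of evaluation are all
-- derived from this formula.
ext-*L : ∀ φ P Q → ext φ (P *L Q) ≡ ext (λ e → ext (λ d → φ (e ⊕ d)) Q) P
ext-*L φ []            Q = refl
ext-*L φ ((e , c) ∷ P) Q = ≡.trans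
  (ext-++ φ (map (λ n → (e ⊕ proj₁ n , c ℤ.* proj₂ n)) Q) (P *L Q))
  (cong₂ ℚ._+_ (ext-scale φ e c Q) (ext-*L φ P Q))

infix 4 _≋_
-- Testing against all functionals, and not only against coefficients, makes each ring law an
-- identity in ℚ and makes invariance of evaluation immediate. That coefficients already suffice is
-- `≈L⇒≋`.
record _≋_ (P Q : LPoly) : Set where
  constructor mk≋
  field at : ∀ φ → ext φ P ≡ ext φ Q
open _≋_

negL : LPoly → LPoly
negL = map (λ m → (proj₁ m , ℤ.- proj₂ m))

ext-neg : ∀ φ P → ext φ (negL P) ≡ ℚ.- ext φ P
ext-neg φ []            = refl
ext-neg φ ((e , c) ∷ P) = ≡.trans
  (cong₂ (λ x y → x ℚ.* φ e ℚ.+ y) (ι-neg c) (ext-neg φ P))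
  (solve 3 (λ c x p → (:- c) :* x :+ (:- p) := :- (c :* x :+ p)) refl (ι c) (φ e) (ext φ P))

ext-sub : ∀ φ P Q → ext φ (P ++ negL Q) ≡ ext φ P ℚ.- ext φ Q
ext-sub φ P Q = ≡.trans (ext-++ φ P (negL Q)) (cong (ext φ P ℚ.+_) (ext-neg φ Q))

x-y≡0⇒x≡y : ∀ {x y} → x ℚ.- y ≡ 0ℚ → x ≡ y
x-y≡0⇒x≡y {x} {y} e = begin
  x               ≡⟨ solve 2 (λ x y → x := x :- y :+ y) refl x y ⟩
  x ℚ.- y ℚ.+ y   ≡⟨ cong (ℚ._+ y) e ⟩
  0ℚ ℚ.+ y        ≡⟨ ℚP.+-identityˡ y ⟩
  y               ∎
  where open ≡.≡-Reasoning

sub≋0⇒≋ : ∀ {P Q} → (P ++ negL Q) ≋ [] → P ≋ Q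
sub≋0⇒≋ {P} {Q} e .at φ = x-y≡0⇒x≡y (≡.trans (≡.sym (ext-sub φ P Q)) (e .at φ))

remove : Exp → LPoly → LPoly
remove e = filter (λ m → ¬? (proj₁ m ≟ₑ e))

ext-remove : ∀ φ e P → ext φ P ≡ ext (δ e) P ℚ.* φ e ℚ.+ ext φ (remove e P)
ext-remove φ e [] = solve 1 (λ x → con 0ℚ := con 0ℚ :* x :+ con 0ℚ) refl (φ e)
ext-remove φ e ((d , c) ∷ P) with d ≟ₑ e
... | yes refl = ≡.trans (cong (ι c ℚ.* φ e ℚ.+_) (ext-remove φ e P))
  (solve 4 (λ c x p q → c :* x :+ (p :* x :+ q) := (c :* con 1ℚ :+ p) :* x :+ q) refl
    (ι c) (φ e) (ext (δ e) P) (ext φ (remove e P)))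
... | no _ = ≡.trans (cong (ι c ℚ.* φ d ℚ.+_) (ext-remove φ e P))
  (solve 5 (λ c x y p q → c :* x :+ (p :* y :+ q) := (c :* con 0ℚ :+ p) :* y :+ (c :* x :+ q)) refl
    (ι c) (φ d) (φ e) (ext (δ e) P) (ext φ (remove e P)))

ext-remove-zero : ∀ φ e P → ext (δ e) P ≡ 0ℚ → ext φ P ≡ ext φ (remove e P)
ext-remove-zero φ e P c≡0 = begin
  ext φ P                                          ≡⟨ ext-remove φ e P ⟩
  ext (δ e) P ℚ.* φ e ℚ.+ ext φ (remove e P)       ≡⟨ cong (λ z → z ℚ.* φ e ℚ.+ ext φ (remove e P)) c≡0 ⟩
  0ℚ ℚ.* φ e ℚ.+ ext φ (remove e P)                ≡⟨ solve 2 (λ x q → con 0ℚ :* x :+ q := q) refl (φ e) _ ⟩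
  ext φ (remove e P)                               ∎
  where open ≡.≡-Reasoning

length-remove : ∀ {e P} → Any (λ m → proj₁ m ≡ e) P → length (remove e P) ℕ.< length P
length-remove {e} {P} e∈P =
  ListP.filter-notAll (λ m → ¬? (proj₁ m ≟ₑ e)) P (Any.map (λ d≡e d≢e → d≢e d≡e) e∈P)

LPoly-rec : ∀ {ℓ} (R : LPoly → Set ℓ) →
  (∀ P → (∀ Q → length Q ℕ.< length P → R Q) → R P) → ∀ P → R P
LPoly-rec R step P = <-rec (λ k → ∀ P → length P ≡ k → R P)
  (λ { _ rec P refl → step P (λ Q Q<P → rec Q<P Q refl) }) (length P) P refl

-- A functional sees an exponent only through its total coefficient. If that is zero, every monomial
-- with the exponent of the head may be dropped without changing any functional or any other
-- coefficient, and the list becomes shorter.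
δ-zero⇒≋[] : ∀ P → (∀ e → ext (δ e) P ≡ 0ℚ) → P ≋ []
δ-zero⇒≋[] = LPoly-rec _ step
  where
  step : ∀ P → (∀ Q → length Q ℕ.< length P → (∀ e → ext (δ e) Q ≡ 0ℚ) → Q ≋ []) →
    (∀ e → ext (δ e) P ≡ 0ℚ) → P ≋ []
  step []                rec z = mk≋ (λ _ → refl)
  step P@((e , c) ∷ P′)  rec z = mk≋ λ φ → ≡.trans (ext-remove-zero φ e P (z e))
    (rec (remove e P) (length-remove {e} {P} (here refl))
       (λ d → ≡.trans (≡.sym (ext-remove-zero (δ d) e P (z e))) (z d)) .at φ)

≈L⇒≋ : ∀ {P Q} → P ≈L Q → P ≋ Q
≈L⇒≋ {P} {Q} P≈Q = sub≋0⇒≋ (δ-zero⇒≋[] (P ++ negL Q) λ e → begin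
  ext (δ e) (P ++ negL Q)              ≡⟨ ext-sub (δ e) P Q ⟩
  ext (δ e) P ℚ.- ext (δ e) Q          ≡⟨ cong₂ ℚ._-_ (ext-δ P e) (ext-δ Q e) ⟩
  ι (coeff P e) ℚ.- ι (coeff Q e)      ≡⟨ cong (λ z → ι z ℚ.- ι (coeff Q e)) (P≈Q e) ⟩
  ι (coeff Q e) ℚ.- ι (coeff Q e)      ≡⟨ ℚP.+-inverseʳ (ι (coeff Q e)) ⟩
  0ℚ                                   ∎)
  where open ≡.≡-Reasoning

-- The commutative semiring of Laurent polynomials

⊕-comm : ∀ {k} (d e : Vec ℤ k) → d ⊕ e ≡ e ⊕ d
⊕-comm = VecP.zipWith-comm ℤP.+-comm

*L-cong : ∀ {P P′ Q Q′} → P ≋ P′ → Q ≋ Q′ → (P *L Q) ≋ (P′ *L Q′)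
*L-cong {P} {P′} {Q} {Q′} eP eQ .at φ = begin
  ext φ (P *L Q)                                ≡⟨ ext-*L φ P Q ⟩
  ext (λ e → ext (λ d → φ (e ⊕ d)) Q) P         ≡⟨ eP .at _ ⟩
  ext (λ e → ext (λ d → φ (e ⊕ d)) Q) P′        ≡⟨ ext-cong (λ e → eQ .at _) P′ ⟩
  ext (λ e → ext (λ d → φ (e ⊕ d)) Q′) P′       ≡⟨ ext-*L φ P′ Q′ ⟨
  ext φ (P′ *L Q′)                              ∎
  where open ≡.≡-Reasoning

*L-comm : ∀ P Q → (P *L Q) ≋ (Q *L P)
*L-comm P Q .at φ = begin
  ext φ (P *L Q)                                ≡⟨ ext-*L φ P Q ⟩
  ext (λ e → ext (λ d → φ (e ⊕ d)) Q) P         ≡⟨ ext-swap (λ e d → φ (e ⊕ d)) P Q ⟩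
  ext (λ d → ext (λ e → φ (e ⊕ d)) P) Q         ≡⟨ ext-cong (λ d → ext-cong (λ e → cong φ (⊕-comm e d)) P) Q ⟩
  ext (λ d → ext (λ e → φ (d ⊕ e)) P) Q         ≡⟨ ext-*L φ Q P ⟨
  ext φ (Q *L P)                                ∎
  where open ≡.≡-Reasoning

*L-assoc : ∀ P Q R → ((P *L Q) *L R) ≋ (P *L (Q *L R))
*L-assoc P Q R .at φ = begin
  ext φ ((P *L Q) *L R)
    ≡⟨ ext-*L φ (P *L Q) R ⟩
  ext (λ e → ext (λ d → φ (e ⊕ d)) R) (P *L Q)
    ≡⟨ ext-*L _ P Q ⟩
  ext (λ e → ext (λ d → ext (λ c → φ (e ⊕ d ⊕ c)) R) Q) P
    ≡⟨ ext-cong (λ e → ext-cong (λ d → ext-cong (λ c → cong φ (VecP.zipWith-assoc ℤP.+-assoc e d c)) R) Q) P ⟩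
  ext (λ e → ext (λ d → ext (λ c → φ (e ⊕ (d ⊕ c))) R) Q) P
    ≡⟨ ext-cong (λ e → ext-*L (λ d → φ (e ⊕ d)) Q R) P ⟨
  ext (λ e → ext (λ d → φ (e ⊕ d)) (Q *L R)) P
    ≡⟨ ext-*L φ P (Q *L R) ⟨
  ext φ (P *L (Q *L R)) ∎
  where open ≡.≡-Reasoning

1L : LPoly
1L = (replicate 5 (+ 0) , + 1) ∷ []

*L-identityˡ : ∀ P → (1L *L P) ≋ P
*L-identityˡ P .at φ = begin
  ext φ (1L *L P)                                         ≡⟨ ext-*L φ 1L P ⟩
  1ℚ ℚ.* ext (λ d → φ (replicate 5 (+ 0) ⊕ d)) P ℚ.+ 0ℚ   ≡⟨ solve 1 (λ x → con 1ℚ :* x :+ con 0ℚ := x) refl _ ⟩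
  ext (λ d → φ (replicate 5 (+ 0) ⊕ d)) P                 ≡⟨ ext-cong (λ d → cong φ
      (VecP.zipWith-identityˡ ℤP.+-identityˡ d)) P ⟩
  ext φ P                                                 ∎
  where open ≡.≡-Reasoning

-- A semiring is the right generality because the derivation of Somos-7 never subtracts; negatives,
-- through `negL`, appear only in deducing equality from a vanishing difference.
laurentSemiring : CommutativeSemiring 0ℓ 0ℓ
laurentSemiring = record
  { Carrier = LPoly
  ; _≈_ = _≋_
  ; _+_ = _+L_
  ; _*_ = _*L_
  ; 0# = []
  ; 1# = 1L
  ; isCommutativeSemiring = isCommutativeSemiringˡ record
    { +-isCommutativeMonoid = record
      { isMonoid = record
        { isSemigroup = record
          { isMagma = record
            { isEquivalence = isEquivalence
            ; ∙-cong = λ {P} {P′} {Q} {Q′} eP eQ → mk≋ λ φ →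
                ≡.trans (ext-++ φ P Q) (≡.trans (cong₂ ℚ._+_ (eP .at φ) (eQ .at φ)) (≡.sym (ext-++ φ P′ Q′)))
            }
          ; assoc = λ P Q R → mk≋ λ φ → cong (ext φ) (ListP.++-assoc P Q R)
          }
        ; identity = (λ P → mk≋ λ φ → refl) , (λ P → mk≋ λ φ → cong (ext φ) (ListP.++-identityʳ P))
        }
      ; comm = λ P Q → mk≋ λ φ →
          ≡.trans (ext-++ φ P Q) (≡.trans (ℚP.+-comm (ext φ P) (ext φ Q)) (≡.sym (ext-++ φ Q P)))
      }
    ; *-isCommutativeMonoid = record
      { isMonoid = record
        { isSemigroup = record
          { isMagma = record { isEquivalence = isEquivalence ; ∙-cong = *L-cong }
          ; assoc = *L-assoc
          }
        ; identity = *L-identityˡ , λ P → ≋-trans (*L-comm P 1L) (*L-identityˡ P)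
        }
      ; comm = *L-comm
      }
    ; distribʳ = λ R P Q → mk≋ λ φ → ≡.trans (ext-*L φ (P ++ Q) R) (≡.trans (ext-++ _ P Q)
        (≡.trans (cong₂ ℚ._+_ (≡.sym (ext-*L φ P R)) (≡.sym (ext-*L φ Q R))) (≡.sym (ext-++ φ (P *L R) (Q *L R)))))
    ; zeroˡ = λ P → mk≋ λ φ → refl
    }
  }
  where
  ≋-trans : ∀ {P Q R} → P ≋ Q → Q ≋ R → P ≋ R
  ≋-trans e f = mk≋ λ φ → ≡.trans (e .at φ) (f .at φ)
  isEquivalence : IsEquivalence _≋_
  isEquivalence = record
    { refl = mk≋ λ φ → refl ; sym = λ e → mk≋ λ φ → ≡.sym (e .at φ) ; trans = ≋-trans }

-- Leading monomials and the absence of zero divisors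

infix 4 _<ₗ_
-- The lexicographic order on exponents. It is total and invariant under translation, which is what
-- a leading-term argument requires; it is not well-founded on ℤᵏ for positive k, and maxima are
-- only taken over finite lists.
data _<ₗ_ : ∀ {k} → Vec ℤ k → Vec ℤ k → Set where
  here  : ∀ {k a b} {as bs : Vec ℤ k} → a ℤ.< b → (a ∷ as) <ₗ (b ∷ bs)
  there : ∀ {k a} {as bs : Vec ℤ k} → as <ₗ bs → (a ∷ as) <ₗ (a ∷ bs)

<ₗ-irrefl : ∀ {k} {as : Vec ℤ k} → ¬ (as <ₗ as)
<ₗ-irrefl (here a<a)   = ℤP.<-irrefl refl a<a
<ₗ-irrefl (there as<as) = <ₗ-irrefl as<as

<ₗ-trans : ∀ {k} {as bs cs : Vec ℤ k} → as <ₗ bs → bs <ₗ cs → as <ₗ cs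
<ₗ-trans (here p)  (here q)  = here (ℤP.<-trans p q)
<ₗ-trans (here p)  (there q) = here p
<ₗ-trans (there p) (here q)  = here q
<ₗ-trans (there p) (there q) = there (<ₗ-trans p q)

<ₗ-cmp : ∀ {k} (as bs : Vec ℤ k) → as <ₗ bs ⊎ as ≡ bs ⊎ bs <ₗ as
<ₗ-cmp [] [] = inj₂ (inj₁ refl)
<ₗ-cmp (a ∷ as) (b ∷ bs) with ℤP.<-cmp a b
... | tri< a<b _ _ = inj₁ (here a<b)
... | tri> _ _ b<a = inj₂ (inj₂ (here b<a))
... | tri≈ _ refl _ with <ₗ-cmp as bs
...   | inj₁ as<bs        = inj₁ (there as<bs)
...   | inj₂ (inj₁ refl)  = inj₂ (inj₁ refl)
...   | inj₂ (inj₂ bs<as) = inj₂ (inj₂ (there bs<as))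

⊕-monoʳ-<ₗ : ∀ {k} (cs : Vec ℤ k) {as bs} → as <ₗ bs → cs ⊕ as <ₗ cs ⊕ bs
⊕-monoʳ-<ₗ (c ∷ cs) (here a<b)    = here (ℤP.+-monoʳ-< c a<b)
⊕-monoʳ-<ₗ (c ∷ cs) (there as<bs) = there (⊕-monoʳ-<ₗ cs as<bs)

⊕-monoˡ-<ₗ : ∀ {k} (cs : Vec ℤ k) {as bs} → as <ₗ bs → as ⊕ cs <ₗ bs ⊕ cs
⊕-monoˡ-<ₗ cs {as} {bs} as<bs rewrite ⊕-comm as cs | ⊕-comm bs cs = ⊕-monoʳ-<ₗ cs as<bs

IsMaxExp : Exp → LPoly → Set
IsMaxExp e P = Any (λ m → proj₁ m ≡ e) P × All (λ m → proj₁ m <ₗ e ⊎ proj₁ m ≡ e) P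

maxExp : ∀ m P → ∃ λ e → IsMaxExp e (m ∷ P)
maxExp (d , c) [] = d , here refl , inj₂ refl ∷ []
maxExp (d , c) (n ∷ P) with maxExp n P
... | e , e∈ , P≤e with <ₗ-cmp d e
...   | inj₁ d<e        = e , there e∈ , inj₁ d<e ∷ P≤e
...   | inj₂ (inj₁ d≡e) = e , there e∈ , inj₂ d≡e ∷ P≤e
...   | inj₂ (inj₂ e<d) = d , here refl , inj₂ refl ∷ All.map
  (λ { (inj₁ x<e) → inj₁ (<ₗ-trans x<e e<d) ; (inj₂ refl) → inj₁ e<d }) P≤e

record LeadingForm (P : LPoly) : Set where
  field
    lead     : Exp
    leadC    : ℤ
    rest     : LPoly
    leadC≢0  : ι leadC ≢ 0ℚ
    rest<    : All (λ m → proj₁ m <ₗ lead) rest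
    form     : P ≋ ((lead , leadC) ∷ rest)

-- The largest exponent written in the list need not be the leading one, because its monomials may
-- cancel. In that case all of them are removed and the search continues in a shorter list.
leadingForm : ∀ P → P ≋ [] ⊎ LeadingForm P
leadingForm = LPoly-rec _ step
  where
  step : ∀ P → (∀ Q → length Q ℕ.< length P → Q ≋ [] ⊎ LeadingForm Q) → P ≋ [] ⊎ LeadingForm P
  step [] rec = inj₁ (mk≋ λ _ → refl)
  step P@(m ∷ P′) rec with maxExp m P′
  ... | e , e∈P , P≤e with ext (δ e) P ℚP.≟ 0ℚ
  ...   | no c≢0 = inj₂ record
    { lead    = e
    ; leadC   = coeff P e
    ; rest    = remove e P
    ; leadC≢0 = λ c≡0 → c≢0 (≡.trans (ext-δ P e) c≡0)
    ; rest<   = All.zipWith (λ { (d≢e , inj₁ d<e) → d<e ; (d≢e , inj₂ d≡e) → contradiction d≡e d≢e })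
                  (AllP.all-filter (λ m → ¬? (proj₁ m ≟ₑ e)) P , AllP.filter⁺ (λ m → ¬? (proj₁ m ≟ₑ e)) P≤e)
    ; form    = mk≋ λ φ → ≡.trans (ext-remove φ e P)
                  (cong (λ z → z ℚ.* φ e ℚ.+ ext φ (remove e P)) (ext-δ P e))
    }
  ...   | yes c≡0 with rec (remove e P) (length-remove {e} {P} e∈P)
  ...     | inj₁ z = inj₁ (mk≋ λ φ → ≡.trans (ext-remove-zero φ e P c≡0) (z .at φ))
  ...     | inj₂ l = inj₂ record
    { LeadingForm l
    ; form = mk≋ λ φ → ≡.trans (ext-remove-zero φ e P c≡0) (LeadingForm.form l .at φ)
    }

ext-lead : ∀ φ e c P → All (λ m → φ (proj₁ m) ≡ 0ℚ) P → ext φ ((e , c) ∷ P) ≡ ι c ℚ.* φ e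
ext-lead φ e c P z = ≡.trans (cong (ι c ℚ.* φ e ℚ.+_) (ext-vanish z)) (ℚP.+-identityʳ _)

-- The coefficient of the product at `top` is the product of the leading coefficients: every other
-- pair of monomials has an exponent sum strictly below `top`.
*L-leading : ∀ {P Q} → LeadingForm P → LeadingForm Q → ¬ ((P *L Q) ≋ [])
*L-leading {P} {Q} p q PQ≋0 = xy≢0 p.leadC≢0 q.leadC≢0 (begin
  ι p.leadC ℚ.* ι q.leadC                       ≡⟨ cong (ι p.leadC ℚ.*_) diagonal ⟨
  ι p.leadC ℚ.* ext (λ d → δ top (p.lead ⊕ d)) Q₀ ≡⟨ ext-lead (λ e → ext (λ d → δ top (e ⊕ d)) Q₀)
      p.lead p.leadC p.rest offDiagonal ⟨
  ext (λ e → ext (λ d → δ top (e ⊕ d)) Q₀) P₀   ≡⟨ ext-*L (δ top) P₀ Q₀ ⟨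
  ext (δ top) (P₀ *L Q₀)                        ≡⟨ *L-cong p.form q.form .at (δ top) ⟨
  ext (δ top) (P *L Q)                          ≡⟨ PQ≋0 .at (δ top) ⟩
  0ℚ                                            ∎)
  where
  open ≡.≡-Reasoning
  module p = LeadingForm p
  module q = LeadingForm q
  top = p.lead ⊕ q.lead
  P₀ = (p.lead , p.leadC) ∷ p.rest
  Q₀ = (q.lead , q.leadC) ∷ q.rest
  below : ∀ {x} → x <ₗ top → δ top x ≡ 0ℚ
  below {x} x<top = δ-≢ {x} {top} λ { refl → <ₗ-irrefl x<top }
  diagonal : ext (λ d → δ top (p.lead ⊕ d)) Q₀ ≡ ι q.leadC
  diagonal = begin
    ext (λ d → δ top (p.lead ⊕ d)) Q₀
      ≡⟨ ext-lead (λ d → δ top (p.lead ⊕ d)) q.lead q.leadC q.rest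
           (All.map (λ d<q → below (⊕-monoʳ-<ₗ p.lead d<q)) q.rest<) ⟩
    ι q.leadC ℚ.* δ top top   ≡⟨ cong (ι q.leadC ℚ.*_) (δ-refl top) ⟩
    ι q.leadC ℚ.* 1ℚ          ≡⟨ ℚP.*-identityʳ _ ⟩
    ι q.leadC                 ∎
  offDiagonal : All (λ m → ext (λ d → δ top (proj₁ m ⊕ d)) Q₀ ≡ 0ℚ) p.rest
  offDiagonal = All.map (λ {m} e<p → ext-vanish {λ d → δ top (proj₁ m ⊕ d)} {Q₀}
    (below (⊕-monoˡ-<ₗ q.lead e<p) ∷
     All.map (λ {n} d<q → below (<ₗ-trans (⊕-monoʳ-<ₗ (proj₁ m) d<q) (⊕-monoˡ-<ₗ q.lead e<p))) q.rest<)) p.rest<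

*L-noZeroDivisors : ∀ P Q → ¬ (P ≋ []) → (P *L Q) ≋ [] → Q ≋ []
*L-noZeroDivisors P Q P≉0 PQ≋0 with leadingForm P | leadingForm Q
... | inj₁ P≋0 | _        = contradiction P≋0 P≉0
... | inj₂ p   | inj₁ Q≋0 = Q≋0
... | inj₂ p   | inj₂ q   = contradiction PQ≋0 (*L-leading p q)

*L-cancelˡ : ∀ P Q R → ¬ (P ≋ []) → (P *L Q) ≋ (P *L R) → Q ≋ R
*L-cancelˡ P Q R P≉0 e = sub≋0⇒≋ (*L-noZeroDivisors P (Q ++ negL R) P≉0 (mk≋ λ φ → begin
  ext φ (P *L (Q ++ negL R))                              ≡⟨ *L-comm P (Q ++ negL R) .at φ ⟩
  ext φ ((Q ++ negL R) *L P)                              ≡⟨ ext-*L φ (Q ++ negL R) P ⟩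
  ext (λ d → ext (λ c → φ (d ⊕ c)) P) (Q ++ negL R)       ≡⟨ ext-sub _ Q R ⟩
  ext (λ d → ext (λ c → φ (d ⊕ c)) P) Q ℚ.- ext (λ d → ext (λ c → φ (d ⊕ c)) P) R
    ≡⟨ cong₂ ℚ._-_ (ext-*L φ Q P) (ext-*L φ R P) ⟨
  ext φ (Q *L P) ℚ.- ext φ (R *L P)                       ≡⟨ cong₂ ℚ._-_ (*L-comm Q P .at φ) (*L-comm R P .at φ) ⟩
  ext φ (P *L Q) ℚ.- ext φ (P *L R)                       ≡⟨ cong (ℚ._- ext φ (P *L R)) (e .at φ) ⟩
  ext φ (P *L R) ℚ.- ext φ (P *L R)                       ≡⟨ ℚP.+-inverseʳ (ext φ (P *L R)) ⟩
  0ℚ                                                      ∎))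
  where open ≡.≡-Reasoning

-- Evaluation at points with nonzero coordinates

NonZeroVec : ∀ {k} → Vec ℚ k → Set
NonZeroVec = VecAll.All (_≢ 0ℚ)

powℕ-+ : ∀ q m n → powℕ q (m ℕ.+ n) ≡ powℕ q m ℚ.* powℕ q n
powℕ-+ q zero    n = ≡.sym (ℚP.*-identityˡ _)
powℕ-+ q (suc m) n = ≡.trans (cong (q ℚ.*_) (powℕ-+ q m n)) (≡.sym (ℚP.*-assoc q _ _))

powℤ-⊖ : ∀ {q} → q ≢ 0ℚ → ∀ m n → powℤ q (m ℤ.⊖ n) ≡ powℕ q m ℚ.* powℕ (inv q) n
powℤ-⊖ q≢0 m       zero    = ≡.sym (ℚP.*-identityʳ _)
powℤ-⊖ q≢0 zero    (suc n) = ≡.sym (ℚP.*-identityˡ _)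
powℤ-⊖ {q} q≢0 (suc m) (suc n) = begin
  powℤ q (suc m ℤ.⊖ suc n)                                  ≡⟨ cong (powℤ q) (ℤP.[1+m]⊖[1+n]≡m⊖n m n) ⟩
  powℤ q (m ℤ.⊖ n)                                          ≡⟨ powℤ-⊖ q≢0 m n ⟩
  powℕ q m ℚ.* powℕ (inv q) n                               ≡⟨ ℚP.*-identityˡ _ ⟨
  1ℚ ℚ.* (powℕ q m ℚ.* powℕ (inv q) n)                      ≡⟨ cong (ℚ._* (powℕ q m ℚ.* powℕ (inv q) n)) (inv-inverseˡ q≢0) ⟨
  inv q ℚ.* q ℚ.* (powℕ q m ℚ.* powℕ (inv q) n)             ≡⟨ solve 4 (λ i q x y → i :* q :* (x :* y) := q :* x :* (i :* y)) refl
      (inv q) q (powℕ q m) (powℕ (inv q) n) ⟩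
  q ℚ.* powℕ q m ℚ.* (inv q ℚ.* powℕ (inv q) n)             ∎
  where open ≡.≡-Reasoning

-- With the convention `inv 0ℚ = 0ℚ` the law fails at zero: the powers with exponents 1 and -1
-- multiply to 0, while the power with exponent 0 is 1. This is why evaluation is multiplicative
-- only under `NonZeroVec`.
powℤ-+ : ∀ {q} → q ≢ 0ℚ → ∀ m n → powℤ q (m ℤ.+ n) ≡ powℤ q m ℚ.* powℤ q n
powℤ-+ q≢0 (+ m)    (+ n)    = powℕ-+ _ m n
powℤ-+ q≢0 (+ m)    -[1+ n ] = powℤ-⊖ q≢0 m (suc n)
powℤ-+ q≢0 -[1+ m ] (+ n)    = ≡.trans (powℤ-⊖ q≢0 n (suc m)) (ℚP.*-comm (powℕ _ n) _)
powℤ-+ {q} q≢0 -[1+ m ] -[1+ n ] =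
  ≡.trans (cong (powℕ (inv q)) (cong suc (≡.sym (ℕP.+-suc m n)))) (powℕ-+ (inv q) (suc m) (suc n))

evalMono-⊕ : ∀ {k} {v : Vec ℚ k} → NonZeroVec v → ∀ d e →
  evalMono v (d ⊕ e) ≡ evalMono v d ℚ.* evalMono v e
evalMono-⊕ []          []       []       = refl
evalMono-⊕ {v = q ∷ v} (q≢0 ∷ v≢0) (a ∷ d) (b ∷ e) = ≡.trans
  (cong₂ ℚ._*_ (powℤ-+ q≢0 a b) (evalMono-⊕ v≢0 d e))
  (solve 4 (λ a b x y → a :* b :* (x :* y) := a :* x :* (b :* y)) refl
    (powℤ q a) (powℤ q b) (evalMono v d) (evalMono v e))

eval-+L : ∀ v P Q → eval v (P +L Q) ≡ eval v P ℚ.+ eval v Q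
eval-+L v = ext-++ (evalMono v)

eval-*L : ∀ {v} → NonZeroVec v → ∀ P Q → eval v (P *L Q) ≡ eval v P ℚ.* eval v Q
eval-*L {v} v≢0 P Q = begin
  ext μ (P *L Q)                               ≡⟨ ext-*L μ P Q ⟩
  ext (λ d → ext (λ e → μ (d ⊕ e)) Q) P        ≡⟨ ext-cong (λ d → ext-cong (evalMono-⊕ v≢0 d) Q) P ⟩
  ext (λ d → ext (λ e → μ d ℚ.* μ e) Q) P      ≡⟨ ext-cong (λ d → ≡.trans (ext-* (μ d) μ Q) (ℚP.*-comm (μ d) _)) P ⟩
  ext (λ d → ext μ Q ℚ.* μ d) P                ≡⟨ ext-* (ext μ Q) μ P ⟩
  ext μ Q ℚ.* ext μ P                          ≡⟨ ℚP.*-comm (ext μ Q) (ext μ P) ⟩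
  ext μ P ℚ.* ext μ Q                          ∎
  where
  open ≡.≡-Reasoning
  μ = evalMono v

eval-≋ : ∀ v {P Q} → P ≋ Q → eval v P ≡ eval v Q
eval-≋ v e = e .at (evalMono v)

eval-var : ∀ v i → eval v (var i) ≡ lookup v i
eval-var (_ ∷ _ ∷ _ ∷ _ ∷ _ ∷ []) zero = solve 1 (λ x →
  con 1ℚ :* (x :* con 1ℚ :* (con 1ℚ :* (con 1ℚ :* (con 1ℚ :* (con 1ℚ :* con 1ℚ))))) :+ con 0ℚ := x) refl _
eval-var (_ ∷ _ ∷ _ ∷ _ ∷ _ ∷ []) (suc zero) = solve 1 (λ x →
  con 1ℚ :* (con 1ℚ :* (x :* con 1ℚ :* (con 1ℚ :* (con 1ℚ :* (con 1ℚ :* con 1ℚ))))) :+ con 0ℚ := x) refl _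
eval-var (_ ∷ _ ∷ _ ∷ _ ∷ _ ∷ []) (suc (suc zero)) = solve 1 (λ x →
  con 1ℚ :* (con 1ℚ :* (con 1ℚ :* (x :* con 1ℚ :* (con 1ℚ :* (con 1ℚ :* con 1ℚ))))) :+ con 0ℚ := x) refl _
eval-var (_ ∷ _ ∷ _ ∷ _ ∷ _ ∷ []) (suc (suc (suc zero))) = solve 1 (λ x →
  con 1ℚ :* (con 1ℚ :* (con 1ℚ :* (con 1ℚ :* (x :* con 1ℚ :* (con 1ℚ :* con 1ℚ))))) :+ con 0ℚ := x) refl _
eval-var (_ ∷ _ ∷ _ ∷ _ ∷ _ ∷ []) (suc (suc (suc (suc zero)))) = solve 1 (λ x →
  con 1ℚ :* (con 1ℚ :* (con 1ℚ :* (con 1ℚ :* (con 1ℚ :* (x :* con 1ℚ :* con 1ℚ))))) :+ con 0ℚ := x) refl _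

-- p-adic integers in ℚ

↥↧-fraction : ∀ q → q ℚ.* ι (↧ q) ≡ ι (↥ q)
↥↧-fraction q@(mkℚ n d-1 _) = ℚP.toℚᵘ-injective (begin
  ℚ.toℚᵘ (q ℚ.* ι (↧ q))                 ≈⟨ ℚP.toℚᵘ-homo-* q (ι (↧ q)) ⟩
  ℚ.toℚᵘ q ℚᵘ.* ℚ.toℚᵘ (ι (↧ q))         ≈⟨ ℚᵘP.*-congˡ {ℚ.toℚᵘ q} (toℚᵘ-ι (↧ q)) ⟩
  ℚ.toℚᵘ q ℚᵘ.* ℚᵘ.mkℚᵘ (↧ q) 0          ≈⟨ ℚᵘ.*≡* (ℤP.*-assoc n (↧ q) (+ 1)) ⟩
  ℚᵘ.mkℚᵘ (↥ q) 0                        ≈⟨ toℚᵘ-ι (↥ q) ⟨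
  ℚ.toℚᵘ (ι (↥ q))                       ∎)
  where open import Relation.Binary.Reasoning.Setoid ℚᵘP.≃-setoid

fraction-cross : ∀ {q n d} → q ℚ.* ι d ≡ ι n → ↥ q ℤ.* d ≡ n ℤ.* ↧ q
fraction-cross {q} {n} {d} e = ι-injective (begin
  ι (↥ q ℤ.* d)              ≡⟨ ι-* (↥ q) d ⟩
  ι (↥ q) ℚ.* ι d            ≡⟨ cong (ℚ._* ι d) (↥↧-fraction q) ⟨
  q ℚ.* ι (↧ q) ℚ.* ι d      ≡⟨ solve 3 (λ q x y → q :* x :* y := q :* y :* x) refl q (ι (↧ q)) (ι d) ⟩
  q ℚ.* ι d ℚ.* ι (↧ q)      ≡⟨ cong (ℚ._* ι (↧ q)) e ⟩
  ι n ℚ.* ι (↧ q)            ≡⟨ ι-* n (↧ q) ⟨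
  ι (n ℤ.* ↧ q)              ∎)
  where open ≡.≡-Reasoning

module PAdic (p : ℕ) (pr : Prime p) where

  private instance
    p-nonZero : ℕ.NonZero p
    p-nonZero = prime⇒nonZero pr

  infix 4 p∣_
  p∣_ : ℤ → Set
  p∣ n = p ∣ ℤ.∣ n ∣

  private
    signed : ∀ {n} → p∣ n → + p Signed.∣ n
    signed = Signed.∣ᵤ⇒∣
    unsigned : ∀ {n} → + p Signed.∣ n → p∣ n
    unsigned = Signed.∣⇒∣ᵤ

  p∣-+ : ∀ {m n} → p∣ m → p∣ n → p∣ m ℤ.+ n
  p∣-+ {m} {n} pm pn = unsigned (Signed.∣m∣n⇒∣m+n (signed {m} pm) (signed {n} pn))

  p∣-*ˡ : ∀ m {n} → p∣ n → p∣ m ℤ.* n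
  p∣-*ˡ m {n} pn = unsigned (Signed.∣n⇒∣m*n m (signed {n} pn))

  p∣-*ʳ : ∀ {m} n → p∣ m → p∣ m ℤ.* n
  p∣-*ʳ {m} n pm = unsigned (Signed.∣m⇒∣m*n n (signed {m} pm))

  p∣-prime : ∀ m n → p∣ m ℤ.* n → p∣ m ⊎ p∣ n
  p∣-prime m n pmn = euclidsLemma ℤ.∣ m ∣ ℤ.∣ n ∣ pr (subst (p ∣_) (ℤP.abs-* m n) pmn)

  p∤-* : ∀ {m n} → ¬ (p∣ m) → ¬ (p∣ n) → ¬ (p∣ m ℤ.* n)
  p∤-* {m} {n} pm pn pmn with p∣-prime m n pmn
  ... | inj₁ x = pm x
  ... | inj₂ x = pn x

  p∣-cancelʳ : ∀ {m n} → ¬ (p∣ n) → p∣ m ℤ.* n → p∣ m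
  p∣-cancelʳ {m} {n} ¬pn pmn with p∣-prime m n pmn
  ... | inj₁ x = x
  ... | inj₂ x = contradiction x ¬pn

  %ℕ-≡⇒p∣- : ∀ m n → m ℤ.%ℕ p ≡ n ℤ.%ℕ p → p∣ m ℤ.- n
  %ℕ-≡⇒p∣- m n e = unsigned (Signed.divides (m ℤ./ℕ p ℤ.- n ℤ./ℕ p) (begin
    m ℤ.- n
      ≡⟨ cong₂ ℤ._-_ (a≡a%ℕn+[a/ℕn]*n m p) (a≡a%ℕn+[a/ℕn]*n n p) ⟩
    (+ (m ℤ.%ℕ p) ℤ.+ (m ℤ./ℕ p) ℤ.* + p) ℤ.- (+ (n ℤ.%ℕ p) ℤ.+ (n ℤ./ℕ p) ℤ.* + p)
      ≡⟨ cong (λ r → (+ r ℤ.+ (m ℤ./ℕ p) ℤ.* + p) ℤ.- (+ (n ℤ.%ℕ p) ℤ.+ (n ℤ./ℕ p) ℤ.* + p)) e ⟩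
    (+ (n ℤ.%ℕ p) ℤ.+ (m ℤ./ℕ p) ℤ.* + p) ℤ.- (+ (n ℤ.%ℕ p) ℤ.+ (n ℤ./ℕ p) ℤ.* + p)
      ≡⟨ Z.solve 4 (λ r x y p → (r Z.:+ x Z.:* p) Z.:- (r Z.:+ y Z.:* p) Z.:= (x Z.:- y) Z.:* p) refl
           (+ (n ℤ.%ℕ p)) (m ℤ./ℕ p) (n ℤ./ℕ p) (+ p) ⟩
    (m ℤ./ℕ p ℤ.- n ℤ./ℕ p) ℤ.* + p ∎))
    where
    open ≡.≡-Reasoning
    module Z = ℤ-Solver

  record Int (q : ℚ) : Set where
    constructor mkInt
    field pint : PInt p q
  open Int public

  -- The condition |q|_p < 1. Fractions are in lowest terms, so it entails integrality; zero is
  -- included.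
  record Div (q : ℚ) : Set where
    constructor mkDiv
    field div : p∣ (↥ q)
  open Div public

  Div? : ∀ q → Dec (Div q)
  Div? q with p ∣? ℤ.∣ ↥ q ∣
  ... | yes d = yes (mkDiv d)
  ... | no ¬d = no (λ d → ¬d (div d))

  ↥↧-coprime : ∀ q → p∣ (↥ q) → ¬ (p ∣ ↧ₙ q)
  ↥↧-coprime (mkℚ n d-1 c) pn pd =
    ℕ.nonTrivial⇒≢1 {{prime⇒nonTrivial pr}} (Coprime.recompute c (pn , pd))

  Div⇒Int : ∀ {q} → Div q → Int q
  Div⇒Int {q} d = mkInt (↥↧-coprime q (div d))

  -- Integrality is defined by lowest terms, whereas sums and products arrive as arbitrary fractions
  -- n/d. Cross-multiplication gives ↥q · d = n · ↧q, so a factor `p` of ↧q would also divide ↥q,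
  -- against coprimality.
  fraction⇒Int : ∀ {q n d} → q ℚ.* ι d ≡ ι n → ¬ (p∣ d) → Int q
  fraction⇒Int {q} {n} {d} e p∤d = mkInt λ p∣↧ →
    ↥↧-coprime q (p∣-cancelʳ {↥ q} {d} p∤d
      (subst p∣_ (≡.sym (fraction-cross {q} {n} {d} e)) (p∣-*ˡ n {↧ q} p∣↧))) p∣↧

  fraction⇒Div : ∀ {q n d} → q ℚ.* ι d ≡ ι n → ¬ (p∣ d) → p∣ n → Div q
  fraction⇒Div {q} {n} {d} e p∤d p∣n = mkDiv (p∣-cancelʳ {↥ q} {d} p∤d
    (subst p∣_ (≡.sym (fraction-cross {q} {n} {d} e)) (p∣-*ʳ {n} (↧ q) p∣n)))

  private
    sum-fraction : ∀ {x y a b c d} → x ℚ.* ι c ≡ ι a → y ℚ.* ι d ≡ ι b →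
      (x ℚ.+ y) ℚ.* ι (c ℤ.* d) ≡ ι (a ℤ.* d ℤ.+ b ℤ.* c)
    sum-fraction {x} {y} {a} {b} {c} {d} ex ey = begin
      (x ℚ.+ y) ℚ.* ι (c ℤ.* d)                    ≡⟨ cong ((x ℚ.+ y) ℚ.*_) (ι-* c d) ⟩
      (x ℚ.+ y) ℚ.* (ι c ℚ.* ι d)                  ≡⟨ solve 4 (λ x y c d → (x :+ y) :* (c :* d) := x :* c :* d :+ y :* d :* c) refl
          x y (ι c) (ι d) ⟩
      x ℚ.* ι c ℚ.* ι d ℚ.+ y ℚ.* ι d ℚ.* ι c      ≡⟨ cong₂ (λ u v → u ℚ.* ι d ℚ.+ v ℚ.* ι c) ex ey ⟩
      ι a ℚ.* ι d ℚ.+ ι b ℚ.* ι c                  ≡⟨ cong₂ ℚ._+_ (ι-* a d) (ι-* b c) ⟨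
      ι (a ℤ.* d) ℚ.+ ι (b ℤ.* c)                  ≡⟨ ι-+ (a ℤ.* d) (b ℤ.* c) ⟨
      ι (a ℤ.* d ℤ.+ b ℤ.* c)                      ∎
      where open ≡.≡-Reasoning

    product-fraction : ∀ {x y a b c d} → x ℚ.* ι c ≡ ι a → y ℚ.* ι d ≡ ι b →
      (x ℚ.* y) ℚ.* ι (c ℤ.* d) ≡ ι (a ℤ.* b)
    product-fraction {x} {y} {a} {b} {c} {d} ex ey = begin
      (x ℚ.* y) ℚ.* ι (c ℤ.* d)          ≡⟨ cong ((x ℚ.* y) ℚ.*_) (ι-* c d) ⟩
      (x ℚ.* y) ℚ.* (ι c ℚ.* ι d)        ≡⟨ solve 4 (λ x y c d → (x :* y) :* (c :* d) := x :* c :* (y :* d)) refl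
          x y (ι c) (ι d) ⟩
      x ℚ.* ι c ℚ.* (y ℚ.* ι d)          ≡⟨ cong₂ ℚ._*_ ex ey ⟩
      ι a ℚ.* ι b                        ≡⟨ ι-* a b ⟨
      ι (a ℤ.* b)                        ∎
      where open ≡.≡-Reasoning

    neg-fraction : ∀ {x a c} → x ℚ.* ι c ≡ ι a → (ℚ.- x) ℚ.* ι c ≡ ι (ℤ.- a)
    neg-fraction {x} {a} {c} e = begin
      (ℚ.- x) ℚ.* ι c    ≡⟨ ℚP.neg-distribˡ-* x (ι c) ⟨
      ℚ.- (x ℚ.* ι c)    ≡⟨ cong (λ z → ℚ.- z) e ⟩
      ℚ.- ι a            ≡⟨ ι-neg a ⟨
      ι (ℤ.- a)          ∎
      where open ≡.≡-Reasoning

  Int-+ : ∀ {x y} → Int x → Int y → Int (x ℚ.+ y)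
  Int-+ {x} {y} ix iy = fraction⇒Int {x ℚ.+ y} {n = ↥ x ℤ.* ↧ y ℤ.+ ↥ y ℤ.* ↧ x} {d = ↧ x ℤ.* ↧ y}
    (sum-fraction {x} {y} {↥ x} {↥ y} {↧ x} {↧ y} (↥↧-fraction x) (↥↧-fraction y)) (p∤-* {↧ x} {↧ y} (pint ix) (pint iy))

  Int-* : ∀ {x y} → Int x → Int y → Int (x ℚ.* y)
  Int-* {x} {y} ix iy = fraction⇒Int {x ℚ.* y} {n = ↥ x ℤ.* ↥ y} {d = ↧ x ℤ.* ↧ y}
    (product-fraction {x} {y} {↥ x} {↥ y} {↧ x} {↧ y} (↥↧-fraction x) (↥↧-fraction y)) (p∤-* {↧ x} {↧ y} (pint ix) (pint iy))

  Int-neg : ∀ {x} → Int x → Int (ℚ.- x)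
  Int-neg {x} ix = fraction⇒Int {ℚ.- x} {n = ℤ.- ↥ x} {d = ↧ x} (neg-fraction {x} {↥ x} {↧ x} (↥↧-fraction x)) (pint ix)

  Int-- : ∀ {x y} → Int x → Int y → Int (x ℚ.- y)
  Int-- ix iy = Int-+ ix (Int-neg iy)

  Div-+ : ∀ {x y} → Div x → Div y → Div (x ℚ.+ y)
  Div-+ {x} {y} dx dy = fraction⇒Div {x ℚ.+ y} {↥ x ℤ.* ↧ y ℤ.+ ↥ y ℤ.* ↧ x} {↧ x ℤ.* ↧ y}
    (sum-fraction {x} {y} {↥ x} {↥ y} {↧ x} {↧ y} (↥↧-fraction x) (↥↧-fraction y))
    (p∤-* {↧ x} {↧ y} (pint (Div⇒Int dx)) (pint (Div⇒Int dy)))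
    (p∣-+ {↥ x ℤ.* ↧ y} {↥ y ℤ.* ↧ x} (p∣-*ʳ {↥ x} (↧ y) (div dx)) (p∣-*ʳ {↥ y} (↧ x) (div dy)))

  Div-neg : ∀ {x} → Div x → Div (ℚ.- x)
  Div-neg {x} dx = mkDiv (subst (p ∣_)
    (≡.sym (≡.trans (cong ℤ.∣_∣ (ℚP.↥-neg x)) (ℤP.∣-i∣≡∣i∣ (↥ x)))) (div dx))

  Div-- : ∀ {x y} → Div x → Div y → Div (x ℚ.- y)
  Div-- dx dy = Div-+ dx (Div-neg dy)

  Div-* : ∀ {x y} → Int x → Div y → Div (x ℚ.* y)
  Div-* {x} {y} ix dy = fraction⇒Div {x ℚ.* y} {↥ x ℤ.* ↥ y} {↧ x ℤ.* ↧ y}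
    (product-fraction {x} {y} {↥ x} {↥ y} {↧ x} {↧ y} (↥↧-fraction x) (↥↧-fraction y))
    (p∤-* {↧ x} {↧ y} (pint ix) (pint (Div⇒Int dy)))
    (p∣-*ˡ (↥ x) {↥ y} (div dy))

  Div-prime : ∀ {x y} → Int x → Int y → Div (x ℚ.* y) → Div x ⊎ Div y
  Div-prime {x} {y} ix iy dxy = Sum.map mkDiv mkDiv (p∣-prime (↥ x) (↥ y)
    (p∣-cancelʳ {↥ x ℤ.* ↥ y} {↧ (x ℚ.* y)} (pint (Div⇒Int dxy))
      (subst p∣_ (fraction-cross {x ℚ.* y} {↥ x ℤ.* ↥ y} {↧ x ℤ.* ↧ y}
          (product-fraction {x} {y} {↥ x} {↥ y} {↧ x} {↧ y} (↥↧-fraction x) (↥↧-fraction y)))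
        (p∣-*ʳ {↥ (x ℚ.* y)} (↧ x ℤ.* ↧ y) (div dxy)))))

  Div-cancel : ∀ {u x} → Int u → ¬ Div u → Int x → Div (u ℚ.* x) → Div x
  Div-cancel {u} {x} iu ¬du ix dux =
    Sum.[ (λ du → contradiction du ¬du) , (λ dx → dx) ]′ (Div-prime {u} {x} iu ix dux)

  ¬Div-* : ∀ {x y} → Int x → Int y → ¬ Div x → ¬ Div y → ¬ Div (x ℚ.* y)
  ¬Div-* {x} {y} ix iy ¬dx ¬dy dxy = ¬dy (Div-cancel {x} {y} ix ¬dx iy dxy)

  Int-cancel : ∀ {u x} → ¬ Div u → Int u → Int (u ℚ.* x) → Int x
  Int-cancel {u} {x} ¬du iu iux = fraction⇒Int {x} {↥ y ℤ.* ↧ u} {↥ u ℤ.* ↧ y}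
    (begin
      x ℚ.* ι (↥ u ℤ.* ↧ y)               ≡⟨ cong (x ℚ.*_) (ι-* (↥ u) (↧ y)) ⟩
      x ℚ.* (ι (↥ u) ℚ.* ι (↧ y))         ≡⟨ cong (λ z → x ℚ.* (z ℚ.* ι (↧ y))) (↥↧-fraction u) ⟨
      x ℚ.* (u ℚ.* ι (↧ u) ℚ.* ι (↧ y))   ≡⟨ solve 4 (λ x u d e → x :* (u :* d :* e) := u :* x :* e :* d) refl
          x u (ι (↧ u)) (ι (↧ y)) ⟩
      y ℚ.* ι (↧ y) ℚ.* ι (↧ u)           ≡⟨ cong (ℚ._* ι (↧ u)) (↥↧-fraction y) ⟩
      ι (↥ y) ℚ.* ι (↧ u)                 ≡⟨ ι-* (↥ y) (↧ u) ⟨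
      ι (↥ y ℤ.* ↧ u)                     ∎)
    (p∤-* {↥ u} {↧ y} (λ d → ¬du (mkDiv d)) (pint iux))
    where
    open ≡.≡-Reasoning
    y = u ℚ.* x

  infix 4 _≡ₚ_
  _≡ₚ_ : ℚ → ℚ → Set
  x ≡ₚ y = Div (x ℚ.- y)

  ≡ₚ-sub : ∀ {x x′ y y′} → x ≡ₚ x′ → y ≡ₚ y′ → (x ℚ.- y) ≡ₚ (x′ ℚ.- y′)
  ≡ₚ-sub {x} {x′} {y} {y′} ex ey = subst Div
    (solve 4 (λ x x′ y y′ → (x :- x′) :- (y :- y′) := (x :- y) :- (x′ :- y′)) refl x x′ y y′)
    (Div-- ex ey)

  ≡ₚ-+ : ∀ {x x′ y y′} → x ≡ₚ x′ → y ≡ₚ y′ → (x ℚ.+ y) ≡ₚ (x′ ℚ.+ y′)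
  ≡ₚ-+ {x} {x′} {y} {y′} ex ey = subst Div
    (solve 4 (λ x x′ y y′ → (x :- x′) :+ (y :- y′) := (x :+ y) :- (x′ :+ y′)) refl x x′ y y′)
    (Div-+ ex ey)

  ≡ₚ-* : ∀ {x x′ y y′} → Int x′ → Int y → x ≡ₚ x′ → y ≡ₚ y′ → (x ℚ.* y) ≡ₚ (x′ ℚ.* y′)
  ≡ₚ-* {x} {x′} {y} {y′} ix iy ex ey = subst Div
    (solve 4 (λ x x′ y y′ → y :* (x :- x′) :+ x′ :* (y :- y′) := (x :* y) :- (x′ :* y′)) refl x x′ y y′)
    (Div-+ (Div-* iy ex) (Div-* ix ey))

  ≡ₚ-cancel : ∀ {u u′ x x′} → ¬ Div u → Int u → Int x → Int x′ → u ≡ₚ u′ →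
    (x ℚ.* u) ≡ₚ (x′ ℚ.* u′) → x ≡ₚ x′
  ≡ₚ-cancel {u} {u′} {x} {x′} ¬du iu ix ix′ eu e = Div-cancel iu ¬du (Int-- ix ix′) (subst Div
    (solve 4 (λ u u′ x x′ → (x :* u :- x′ :* u′) :- x′ :* (u :- u′) := u :* (x :- x′)) refl u u′ x x′)
    (Div-- e (Div-* ix′ eu)))

  -- A finite code for the residue class that avoids inverting modulo `p`: numerator and denominator
  -- are reduced separately. One class may have several codes, but equal codes force congruence,
  -- which is what the pigeonhole argument uses.
  residues : ℚ → Fin (p ℕ.* p)
  residues q = combine (fromℕ< (n%ℕd<d (↥ q) p)) (fromℕ< (n%ℕd<d (↧ q) p))

  residues-≡ₚ : ∀ {x y} → Int x → Int y → residues x ≡ residues y → x ≡ₚ y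
  residues-≡ₚ {x} {y} ix iy e = fraction⇒Div {x ℚ.- y} {↥ x ℤ.* ↧ y ℤ.+ (ℤ.- ↥ y) ℤ.* ↧ x} {↧ x ℤ.* ↧ y}
    (sum-fraction {x} {ℚ.- y} {↥ x} {ℤ.- ↥ y} {↧ x} {↧ y} (↥↧-fraction x) (neg-fraction {y} {↥ y} {↧ y} (↥↧-fraction y)))
    (p∤-* {↧ x} {↧ y} (pint ix) (pint iy))
    -- The numerator ad - bc of the difference is a(d - c) + (a - b)c, and equal codes make both
    -- bracketed differences multiples of `p`.
    (subst p∣_ (Z.solve 4 (λ a b c d →
         a Z.:* (d Z.:- c) Z.:+ (a Z.:- b) Z.:* c Z.:= a Z.:* d Z.:+ (Z.:- b) Z.:* c) refl
         (↥ x) (↥ y) (↧ x) (↧ y))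
      (p∣-+ {↥ x ℤ.* (↧ y ℤ.- ↧ x)} {(↥ x ℤ.- ↥ y) ℤ.* ↧ x}
        (p∣-*ˡ (↥ x) {↧ y ℤ.- ↧ x} (%ℕ-≡⇒p∣- (↧ y) (↧ x) (≡.sym ≡↧)))
        (p∣-*ʳ {↥ x ℤ.- ↥ y} (↧ x) (%ℕ-≡⇒p∣- (↥ x) (↥ y) ≡↥))))
    where
    module Z = ℤ-Solver
    digits = FinP.combine-injective (fromℕ< (n%ℕd<d (↥ x) p)) (fromℕ< (n%ℕd<d (↧ x) p))
                                    (fromℕ< (n%ℕd<d (↥ y) p)) (fromℕ< (n%ℕd<d (↧ y) p)) e
    ≡↥ : ↥ x ℤ.%ℕ p ≡ ↥ y ℤ.%ℕ p
    ≡↥ = FinP.fromℕ<-injective _ _ (n%ℕd<d (↥ x) p) (n%ℕd<d (↥ y) p) (proj₁ digits)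
    ≡↧ : ↧ x ℤ.%ℕ p ≡ ↧ y ℤ.%ℕ p
    ≡↧ = FinP.fromℕ<-injective _ _ (n%ℕd<d (↧ x) p) (n%ℕd<d (↧ y) p) (proj₂ digits)

-- Sequences satisfying Somos-5 and Somos-7

record Run (P : ℤ → Set) (n : ℤ) (m : ℕ) : Set where
  constructor mkRun
  field nth : ∀ k → k ℕ.< m → P (n ℤ.+ + k)
open Run

run-at : ∀ {P n m} → Run P n m → ∀ k → {True (k ℕP.<? m)} → P (n ℤ.+ + k)
run-at r k {k<m} = nth r k (toWitness k<m)

run-tail : ∀ {P m} n → Run P (n ℤ.+ + 1) m → ∀ k → {True (k ℕP.<? m)} → P (n ℤ.+ + suc k)
run-tail {P} n r k {k<m} = subst P (n+1+k n k) (nth r k (toWitness k<m))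

run-up : ∀ {P n m} → Run P n m → P (n ℤ.+ + m) → Run P (n ℤ.+ + 1) m
run-up {P} {n} r x .nth k k<m with ℕP.m≤n⇒m<n∨m≡n k<m
... | inj₁ 1+k<m = subst P (≡.sym (n+1+k n k)) (nth r (suc k) 1+k<m)
... | inj₂ refl  = subst P (≡.sym (n+1+k n k)) x

run-down : ∀ {P n m} → Run P (n ℤ.+ + 1) m → P n → Run P n m
run-down {P} {n} r x .nth zero    _     = subst P (≡.sym (ℤP.+-identityʳ n)) x
run-down {P} {n} r x .nth (suc k) 1+k<m = subst P (n+1+k n k) (nth r k (ℕP.<⇒≤ 1+k<m))

record Somos57 (D N : ℚ) (a : ℤ → ℚ) : Set where
  field
    somos5 : ∀ n → a (n ℤ.+ + 5) ℚ.* a n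
                 ≡ a (n ℤ.+ + 4) ℚ.* a (n ℤ.+ + 1) ℚ.+ a (n ℤ.+ + 3) ℚ.* a (n ℤ.+ + 2)
    somos7 : ∀ n → D ℚ.* (a (n ℤ.+ + 7) ℚ.* a n ℚ.+ a (n ℤ.+ + 5) ℚ.* a (n ℤ.+ + 2))
                 ≡ N ℚ.* (a (n ℤ.+ + 4) ℚ.* a (n ℤ.+ + 3))

  b : ℤ → ℕ → ℚ
  b n k = a (n ℤ.+ + k)

  private
    +-+ : ∀ n k j → a ((n ℤ.+ + k) ℤ.+ + j) ≡ b n (k ℕ.+ j)
    +-+ n k j = cong a (ℤP.+-assoc n (+ k) (+ j))

  somos5-at : ∀ n k → b n (k ℕ.+ 5) ℚ.* b n k
    ≡ b n (k ℕ.+ 4) ℚ.* b n (k ℕ.+ 1) ℚ.+ b n (k ℕ.+ 3) ℚ.* b n (k ℕ.+ 2)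
  somos5-at n k = ≡.trans (cong (ℚ._* b n k) (≡.sym (+-+ n k 5))) (≡.trans (somos5 (n ℤ.+ + k))
    (cong₂ ℚ._+_ (cong₂ ℚ._*_ (+-+ n k 4) (+-+ n k 1)) (cong₂ ℚ._*_ (+-+ n k 3) (+-+ n k 2))))

  somos7-at : ∀ n → D ℚ.* (b n 7 ℚ.* b n 0 ℚ.+ b n 5 ℚ.* b n 2) ≡ N ℚ.* (b n 4 ℚ.* b n 3)
  somos7-at n = ≡.trans
    (cong (λ z → D ℚ.* (b n 7 ℚ.* a z ℚ.+ b n 5 ℚ.* b n 2)) (ℤP.+-identityʳ n)) (somos7 n)

  -- Both relations are palindromic. Read from the far end of the window they have the shape that
  -- the step lemmas for `t₇` expect, so the same lemmas serve for the descent.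
  somos5-reversed : ∀ n → b n 0 ℚ.* b n 5 ≡ b n 1 ℚ.* b n 4 ℚ.+ b n 2 ℚ.* b n 3
  somos5-reversed n = ≡.trans (ℚP.*-comm (b n 0) (b n 5)) (≡.trans (somos5-at n 0)
    (cong₂ ℚ._+_ (ℚP.*-comm (b n 4) (b n 1)) (ℚP.*-comm (b n 3) (b n 2))))

  somos7-reversed : ∀ n → D ℚ.* (b n 0 ℚ.* b n 7 ℚ.+ b n 2 ℚ.* b n 5) ≡ N ℚ.* (b n 3 ℚ.* b n 4)
  somos7-reversed n = ≡.trans
    (cong (D ℚ.*_) (cong₂ ℚ._+_ (ℚP.*-comm (b n 0) (b n 7)) (ℚP.*-comm (b n 2) (b n 5))))
    (≡.trans (somos7-at n) (cong (N ℚ.*_) (ℚP.*-comm (b n 4) (b n 3))))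

-- The translate satisfies Somos-7 with the same `D` and `N`. This lets a sequence be compared with
-- its own translate by the step lemmas.
Somos57-shift : ∀ {D N a} → Somos57 D N a → ∀ m → Somos57 D N (λ n → a (n ℤ.+ m))
Somos57-shift {D} {N} {a} s m = record
  { somos5 = λ n → ≡.trans (cong (ℚ._* a (n ℤ.+ m)) (swap n 5)) (≡.trans (somos5 (n ℤ.+ m))
      (≡.sym (cong₂ ℚ._+_ (cong₂ ℚ._*_ (swap n 4) (swap n 1)) (cong₂ ℚ._*_ (swap n 3) (swap n 2)))))
  ; somos7 = λ n → ≡.trans
      (cong (D ℚ.*_) (cong₂ ℚ._+_ (cong (ℚ._* a (n ℤ.+ m)) (swap n 7)) (cong₂ ℚ._*_ (swap n 5) (swap n 2))))
      (≡.trans (somos7 (n ℤ.+ m)) (≡.sym (cong (N ℚ.*_) (cong₂ ℚ._*_ (swap n 4) (swap n 3)))))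
  }
  where
  open Somos57 s
  swap : ∀ n k → a ((n ℤ.+ + k) ℤ.+ m) ≡ a ((n ℤ.+ m) ℤ.+ + k)
  swap n k = cong a (≡.trans (ℤP.+-assoc n (+ k) m)
    (≡.trans (cong (λ z → n ℤ.+ z) (ℤP.+-comm (+ k) m)) (≡.sym (ℤP.+-assoc n m (+ k)))))

-- Propagation of integrality and of residues

module Reduction (p : ℕ) (pr : Prime p) (D N : ℚ) (D-int : PAdic.Int p pr D)
  (D-unit : ¬ PAdic.Div p pr D) (N-int : PAdic.Int p pr N) where
  open PAdic p pr

  Div-summand : ∀ {x y u w r s} → x ℚ.* y ≡ u ℚ.* w ℚ.+ r ℚ.* s →
    Int y → Int w → Int r → Int s → Div x → Div u → Div r ⊎ Div s
  Div-summand {x} {y} {u} {w} {r} {s} e iy iw ir is dx du = Div-prime {r} {s} ir is (subst Div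
    (begin
      y ℚ.* x ℚ.- w ℚ.* u                    ≡⟨ cong (ℚ._- w ℚ.* u) (≡.trans (ℚP.*-comm y x) e) ⟩
      (u ℚ.* w ℚ.+ r ℚ.* s) ℚ.- w ℚ.* u      ≡⟨ solve 4 (λ u w r s → (u :* w :+ r :* s) :- w :* u := r :* s) refl u w r s ⟩
      r ℚ.* s                                ∎)
    (Div-- {y ℚ.* x} {w ℚ.* u} (Div-* {y} {x} iy dx) (Div-* {w} {u} iw du)))
    where open ≡.≡-Reasoning

  -- If `p` divides `x` and `u`, it divides `r * s`, hence one of `r` and `s`; that factor and `u`
  -- then form a pair already excluded.
  apart-step : ∀ {x y u w r s} → x ℚ.* y ≡ u ℚ.* w ℚ.+ r ℚ.* s →
    Int y → Int w → Int r → Int s → ¬ (Div u × Div r) → ¬ (Div u × Div s) → ¬ (Div x × Div u)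
  apart-step {x} {y} {u} {w} {r} {s} e iy iw ir is ¬ur ¬us (dx , du) =
    Sum.[ (λ dr → ¬ur (du , dr)) , (λ ds → ¬us (du , ds)) ]′ (Div-summand {x} {y} {u} {w} {r} {s} e iy iw ir is dx du)

  -- Somos-5 determines t₇ when t₂ is a unit, Somos-7 when t₀ is.
  Int-step : ∀ {t₀ t₂ t₃ t₄ t₅ t₆ t₇} →
    t₇ ℚ.* t₂ ≡ t₆ ℚ.* t₃ ℚ.+ t₅ ℚ.* t₄ → D ℚ.* (t₇ ℚ.* t₀ ℚ.+ t₅ ℚ.* t₂) ≡ N ℚ.* (t₄ ℚ.* t₃) →
    Int t₀ → Int t₂ → Int t₃ → Int t₄ → Int t₅ → Int t₆ → ¬ (Div t₀ × Div t₂) → Int t₇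
  Int-step {t₀} {t₂} {t₃} {t₄} {t₅} {t₆} {t₇} r₅ r₇ i₀ i₂ i₃ i₄ i₅ i₆ apart = by-cases (Div? t₂)
    where
    open ≡.≡-Reasoning
    via-somos7 : D ℚ.* t₀ ℚ.* t₇ ≡ N ℚ.* (t₄ ℚ.* t₃) ℚ.- D ℚ.* (t₅ ℚ.* t₂)
    via-somos7 = begin
      D ℚ.* t₀ ℚ.* t₇
        ≡⟨ solve 5 (λ D t₀ t₇ t₅ t₂ → D :* t₀ :* t₇ := D :* (t₇ :* t₀ :+ t₅ :* t₂) :- D :* (t₅ :* t₂)) refl D t₀ t₇ t₅ t₂ ⟩
      D ℚ.* (t₇ ℚ.* t₀ ℚ.+ t₅ ℚ.* t₂) ℚ.- D ℚ.* (t₅ ℚ.* t₂)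
        ≡⟨ cong (ℚ._- D ℚ.* (t₅ ℚ.* t₂)) r₇ ⟩
      N ℚ.* (t₄ ℚ.* t₃) ℚ.- D ℚ.* (t₅ ℚ.* t₂) ∎
    by-cases : Dec (Div t₂) → Int t₇
    by-cases (no ¬d₂) = Int-cancel {t₂} {t₇} ¬d₂ i₂ (subst Int (≡.sym (≡.trans (ℚP.*-comm t₂ t₇) r₅))
      (Int-+ {t₆ ℚ.* t₃} {t₅ ℚ.* t₄} (Int-* {t₆} {t₃} i₆ i₃) (Int-* {t₅} {t₄} i₅ i₄)))
    by-cases (yes d₂) = Int-cancel {D ℚ.* t₀} {t₇}
      (¬Div-* {D} {t₀} D-int i₀ D-unit (λ d₀ → apart (d₀ , d₂))) (Int-* {D} {t₀} D-int i₀)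
      (subst Int (≡.sym via-somos7) (Int-- {N ℚ.* (t₄ ℚ.* t₃)} {D ℚ.* (t₅ ℚ.* t₂)}
        (Int-* {N} {t₄ ℚ.* t₃} N-int (Int-* {t₄} {t₃} i₄ i₃)) (Int-* {D} {t₅ ℚ.* t₂} D-int (Int-* {t₅} {t₂} i₅ i₂))))

  -- The dichotomy of `Int-step` for residues; `D`, a unit, is cancelled from Somos-7. Dividing a
  -- congruence needs a unit on one side only, so apartness is asked of `t` alone.
  ≡ₚ-step : ∀ (t u : ℕ → ℚ) → (∀ k → Int (t k)) → (∀ k → Int (u k)) →
    t 7 ℚ.* t 2 ≡ t 6 ℚ.* t 3 ℚ.+ t 5 ℚ.* t 4 → u 7 ℚ.* u 2 ≡ u 6 ℚ.* u 3 ℚ.+ u 5 ℚ.* u 4 →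
    D ℚ.* (t 7 ℚ.* t 0 ℚ.+ t 5 ℚ.* t 2) ≡ N ℚ.* (t 4 ℚ.* t 3) →
    D ℚ.* (u 7 ℚ.* u 0 ℚ.+ u 5 ℚ.* u 2) ≡ N ℚ.* (u 4 ℚ.* u 3) →
    ¬ (Div (t 0) × Div (t 2)) →
    t 0 ≡ₚ u 0 → t 2 ≡ₚ u 2 → t 3 ≡ₚ u 3 → t 4 ≡ₚ u 4 → t 5 ≡ₚ u 5 → t 6 ≡ₚ u 6 → t 7 ≡ₚ u 7
  ≡ₚ-step t u it iu r₅ r₅′ r₇ r₇′ apart e₀ e₂ e₃ e₄ e₅ e₆ = by-cases (Div? (t 2))
    where
    mul : ∀ i j → t i ≡ₚ u i → t j ≡ₚ u j → (t i ℚ.* t j) ≡ₚ (u i ℚ.* u j)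
    mul i j = ≡ₚ-* {t i} {u i} {t j} {u j} (iu i) (it j)
    scaled : (D ℚ.* (t 7 ℚ.* t 0 ℚ.+ t 5 ℚ.* t 2)) ≡ₚ (D ℚ.* (u 7 ℚ.* u 0 ℚ.+ u 5 ℚ.* u 2))
    scaled = subst Div
      (≡.trans (solve 3 (λ n x y → n :* (x :- y) := n :* x :- n :* y) refl N (t 4 ℚ.* t 3) (u 4 ℚ.* u 3))
        (cong₂ ℚ._-_ (≡.sym r₇) (≡.sym r₇′)))
      (Div-* {N} N-int (mul 4 3 e₄ e₃))
    unscaled : (t 7 ℚ.* t 0 ℚ.+ t 5 ℚ.* t 2) ≡ₚ (u 7 ℚ.* u 0 ℚ.+ u 5 ℚ.* u 2)
    unscaled = Div-cancel {D} D-int D-unit (Int-- {x} {y} (int-x t it) (int-x u iu))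
      (subst Div (solve 3 (λ d x y → d :* x :- d :* y := d :* (x :- y)) refl D x y) scaled)
      where
      x = t 7 ℚ.* t 0 ℚ.+ t 5 ℚ.* t 2
      y = u 7 ℚ.* u 0 ℚ.+ u 5 ℚ.* u 2
      int-x : ∀ (t : ℕ → ℚ) → (∀ k → Int (t k)) → Int (t 7 ℚ.* t 0 ℚ.+ t 5 ℚ.* t 2)
      int-x t it = Int-+ {t 7 ℚ.* t 0} {t 5 ℚ.* t 2} (Int-* {t 7} {t 0} (it 7) (it 0)) (Int-* {t 5} {t 2} (it 5) (it 2))
    by-cases : Dec (Div (t 2)) → t 7 ≡ₚ u 7
    by-cases (no ¬d₂) = ≡ₚ-cancel {t 2} {u 2} {t 7} {u 7} ¬d₂ (it 2) (it 7) (iu 7) e₂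
      (subst Div (cong₂ ℚ._-_ (≡.sym r₅) (≡.sym r₅′))
        (≡ₚ-+ {t 6 ℚ.* t 3} {u 6 ℚ.* u 3} {t 5 ℚ.* t 4} {u 5 ℚ.* u 4} (mul 6 3 e₆ e₃) (mul 5 4 e₅ e₄)))
    by-cases (yes d₂) = ≡ₚ-cancel {t 0} {u 0} {t 7} {u 7} (λ d₀ → apart (d₀ , d₂)) (it 0) (it 7) (iu 7) e₀
      (subst Div (cong₂ ℚ._-_ (drop (t 7 ℚ.* t 0) (t 5 ℚ.* t 2)) (drop (u 7 ℚ.* u 0) (u 5 ℚ.* u 2)))
        (≡ₚ-sub {t 7 ℚ.* t 0 ℚ.+ t 5 ℚ.* t 2} {u 7 ℚ.* u 0 ℚ.+ u 5 ℚ.* u 2} {t 5 ℚ.* t 2} {u 5 ℚ.* u 2}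
          unscaled (mul 5 2 e₅ e₂)))
      where
      drop : ∀ x y → (x ℚ.+ y) ℚ.- y ≡ x
      drop = solve 2 (λ x y → (x :+ y) :- y := x) refl

  module _ {a : ℤ → ℚ} (a-somos : Somos57 D N a) where
    open Somos57 a-somos

    Apart : ℕ → ℤ → Set
    Apart d n = ¬ (Div (a n) × Div (a (n ℤ.+ + d)))

    -- No two of any three consecutive terms are divisible by p; this is what makes Int-step and
    -- ≡ₚ-step applicable, and Somos-5 propagates it.
    record Window (n : ℤ) : Set where
      field
        integral : Run (λ i → Int (a i)) n 7
        apart₁   : Run (Apart 1) n 6
        apart₂   : Run (Apart 2) n 5

    private
      apart-+ : ∀ d n k → ¬ (Div (b n k) × Div (b n (k ℕ.+ d))) → Apart d (n ℤ.+ + k)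
      apart-+ d n k = subst (λ i → ¬ (Div (b n k) × Div (a i))) (≡.sym (ℤP.+-assoc n (+ k) (+ d)))

      apart-+⁻¹ : ∀ d n k → Apart d (n ℤ.+ + k) → ¬ (Div (b n k) × Div (b n (k ℕ.+ d)))
      apart-+⁻¹ d n k = subst (λ i → ¬ (Div (b n k) × Div (a i))) (ℤP.+-assoc n (+ k) (+ d))

      flip : ∀ {x y} → ¬ (Div x × Div y) → ¬ (Div y × Div x)
      flip ¬xy (dy , dx) = ¬xy (dx , dy)

    -- The new term `b n 7` enters through `b n 7 · b n 2 = b n 6 · b n 3 + b n 5 · b n
    -- 4`. If `p` divided it together with `b n 6`, it would divide `b n 5` or `b n
    -- 4`, both too close to `b n 6`; together with `b n 5`, it would divide `b n 6` or `b n
    -- 3`, both too close to `b n 5`.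
    window-up : ∀ n → Window n → Window (n ℤ.+ + 1)
    window-up n w = record
      { integral = run-up integral
          (Int-step {b n 0} {b n 2} {b n 3} {b n 4} {b n 5} {b n 6} {b n 7} (somos5-at n 2) (somos7-at n)
            (i 0) (i 2) (i 3) (i 4) (i 5) (i 6) (A₂ 0))
      ; apart₁ = run-up apart₁ (apart-+ 1 n 6 (flip
          (apart-step {b n 7} {b n 2} {b n 6} {b n 3} {b n 5} {b n 4} (somos5-at n 2)
            (i 2) (i 3) (i 5) (i 4) (flip (A₁ 5)) (flip (A₂ 4)))))
      ; apart₂ = run-up apart₂ (apart-+ 2 n 5 (flip
          (apart-step {b n 7} {b n 2} {b n 5} {b n 4} {b n 6} {b n 3}
            (≡.trans (somos5-at n 2) (ℚP.+-comm (b n 6 ℚ.* b n 3) (b n 5 ℚ.* b n 4)))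
            (i 2) (i 4) (i 6) (i 3) (A₁ 5) (flip (A₂ 3)))))
      }
      where
      open Window w
      i : ∀ k → {True (k ℕP.<? 7)} → Int (b n k)
      i k {k<} = run-at integral k {k<}
      A₁ : ∀ k → {True (k ℕP.<? 6)} → ¬ (Div (b n k) × Div (b n (k ℕ.+ 1)))
      A₁ k {k<} = apart-+⁻¹ 1 n k (run-at apart₁ k {k<})
      A₂ : ∀ k → {True (k ℕP.<? 5)} → ¬ (Div (b n k) × Div (b n (k ℕ.+ 2)))
      A₂ k {k<} = apart-+⁻¹ 2 n k (run-at apart₂ k {k<})

    window-down : ∀ n → Window (n ℤ.+ + 1) → Window n
    window-down n w = record
      { integral = run-down integral (subst (λ z → Int (a z)) (ℤP.+-identityʳ n)
          (Int-step {b n 7} {b n 5} {b n 4} {b n 3} {b n 2} {b n 1} {b n 0} (somos5-reversed n) (somos7-reversed n)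
            (i 6) (i 4) (i 3) (i 2) (i 1) (i 0) (flip (A₂ 4))))
      ; apart₁ = run-down apart₁ (subst (λ z → ¬ (Div (a z) × Div (b n 1))) (ℤP.+-identityʳ n)
          (apart-step {b n 0} {b n 5} {b n 1} {b n 4} {b n 2} {b n 3} (somos5-reversed n)
            (i 4) (i 3) (i 1) (i 2) (A₁ 0) (A₂ 0)))
      ; apart₂ = run-down apart₂ (subst (λ z → ¬ (Div (a z) × Div (b n 2))) (ℤP.+-identityʳ n)
          (apart-step {b n 0} {b n 5} {b n 2} {b n 3} {b n 1} {b n 4}
            (≡.trans (somos5-reversed n) (ℚP.+-comm (b n 1 ℚ.* b n 4) (b n 2 ℚ.* b n 3)))
            (i 4) (i 2) (i 0) (i 3) (flip (A₁ 0)) (A₂ 1)))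
      }
      where
      open Window w
      i : ∀ k → {True (k ℕP.<? 7)} → Int (b n (suc k))
      i k {k<} = run-tail n integral k {k<}
      A₁ : ∀ k → {True (k ℕP.<? 6)} → ¬ (Div (b n (suc k)) × Div (b n (suc k ℕ.+ 1)))
      A₁ k {k<} = apart-+⁻¹ 1 n (suc k) (run-tail n apart₁ k {k<})
      A₂ : ∀ k → {True (k ℕP.<? 5)} → ¬ (Div (b n (suc k)) × Div (b n (suc k ℕ.+ 2)))
      A₂ k {k<} = apart-+⁻¹ 2 n (suc k) (run-tail n apart₂ k {k<})

    module _ (start : Window (+ 0)) where

      window : ∀ n → Window n
      window = ℤ-induction Window start window-up window-down

      terms-integral : ∀ n → Int (a n)
      terms-integral n = subst (λ i → Int (a i)) (ℤP.+-identityʳ n)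
        (run-at (Window.integral (window n)) 0)

      terms-apart₂ : ∀ n → Apart 2 n
      terms-apart₂ n = subst (Apart 2) (ℤP.+-identityʳ n) (run-at (Window.apart₂ (window n)) 0)

      module _ (M : ℕ) where

        private
          c : ℤ → ℚ
          c n = a (n ℤ.+ + M)
          module C = Somos57 (Somos57-shift a-somos (+ M))

        Agree : ℤ → Set
        Agree n = a (n ℤ.+ + M) ≡ₚ a n

        private
          Agree-sym : ∀ {x y} → x ≡ₚ y → y ≡ₚ x
          Agree-sym {x} {y} e = subst Div (solve 2 (λ x y → :- (x :- y) := y :- x) refl x y) (Div-neg e)

        agree-up : ∀ n → Run Agree n 7 → Run Agree (n ℤ.+ + 1) 7
        agree-up n r = run-up r (Agree-sym {b n 7} {c (n ℤ.+ + 7)} (≡ₚ-step (b n) (C.b n)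
          (λ k → terms-integral _) (λ k → terms-integral _)
          (somos5-at n 2) (C.somos5-at n 2) (somos7-at n) (C.somos7-at n)
          (apart-+⁻¹ 2 n 0 (terms-apart₂ (n ℤ.+ + 0))) (e 0) (e 2) (e 3) (e 4) (e 5) (e 6)))
          where
          e : ∀ k → {True (k ℕP.<? 7)} → b n k ≡ₚ C.b n k
          e k {k<} = Agree-sym {C.b n k} {b n k} (run-at r k {k<})

        agree-down : ∀ n → Run Agree (n ℤ.+ + 1) 7 → Run Agree n 7
        agree-down n r = run-down r (subst Agree (ℤP.+-identityʳ n)
          -- The reflection `7 ∸ k` puts the reversed relations into the form of `≡ₚ-step`. Beyond 7
          -- truncated subtraction repeats the term at 0, which keeps the integrality required for
          -- every `k` true.
          (Agree-sym {b n 0} {C.b n 0} (≡ₚ-step (λ k → b n (7 ℕ.∸ k)) (λ k → C.b n (7 ℕ.∸ k))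
          (λ k → terms-integral _) (λ k → terms-integral _)
          (somos5-reversed n) (C.somos5-reversed n) (somos7-reversed n) (C.somos7-reversed n)
          (flip (apart-+⁻¹ 2 n 5 (terms-apart₂ (n ℤ.+ + 5)))) (e 6) (e 4) (e 3) (e 2) (e 1) (e 0))))
          where
          e : ∀ k → {True (k ℕP.<? 7)} → b n (suc k) ≡ₚ C.b n (suc k)
          e k {k<} = Agree-sym {C.b n (suc k)} {b n (suc k)} (run-tail n r k {k<})

        agree-everywhere : ∀ s → Run Agree s 7 → ∀ n → Agree n
        agree-everywhere s r n = subst Agree (ℤP.+-identityʳ n)
          (run-at (ℤ-induction-from (λ n → Run Agree n 7) s r agree-up agree-down n) 0)

      private
        B : ℕ
        B = (p ℕ.* p) ℕ.^ 7

        windowResidues : ℕ → Fin 7 → Fin (p ℕ.* p)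
        windowResidues i k = residues (b (+ i) (toℕ k))

        code : Fin (suc B) → Fin B
        code i = funToFin (windowResidues (toℕ i))

        code-injective : ∀ i j → code i ≡ code j → ∀ k → windowResidues (toℕ i) k ≡ windowResidues (toℕ j) k
        code-injective i j e k = ≡.trans (≡.sym (FinP.finToFun-funToFin (windowResidues (toℕ i)) k))
          (≡.trans (cong (λ z → finToFun z k) e) (FinP.finToFun-funToFin (windowResidues (toℕ j)) k))

      -- The pigeonhole principle only finds two equal windows at some nonnegative positions. As a
      -- window determines its neighbours on both sides, the agreement spreads over all of ℤ and
      -- there is no preperiod.
      periodic : Σ ℕ λ M → 1 ℕ.≤ M × (∀ n → a (n ℤ.+ + M) ≡ₚ a n)
      periodic = from-collision (FinP.pigeonhole (ℕP.n<1+n B) code)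
        where
        from-collision : (∃₂ λ i j → i Fin.< j × code i ≡ code j) →
          Σ ℕ λ M → 1 ℕ.≤ M × (∀ n → a (n ℤ.+ + M) ≡ₚ a n)
        from-collision (i , j , i<j , e) = M , ℕP.m<n⇒0<n∸m i<j , agree-everywhere M (+ toℕ i) run
          where
          M = toℕ j ℕ.∸ toℕ i
          index : ∀ k → (+ toℕ i ℤ.+ + k) ℤ.+ + M ≡ + toℕ j ℤ.+ + k
          index k = cong +_ (≡.trans (ℕP.+-assoc (toℕ i) k M) (≡.trans (cong (toℕ i ℕ.+_) (ℕP.+-comm k M))
            (≡.trans (≡.sym (ℕP.+-assoc (toℕ i) M k)) (cong (ℕ._+ k) (ℕP.m+[n∸m]≡n (ℕP.<⇒≤ i<j))))))
          run : Run (Agree M) (+ toℕ i) 7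
          run .nth k k<7 = subst (λ z → a z ≡ₚ a (+ toℕ i ℤ.+ + k)) (≡.sym (index k))
            (residues-≡ₚ (terms-integral _) (terms-integral _)
              (subst (λ k → residues (b (+ toℕ j) k) ≡ residues (b (+ toℕ i) k)) (FinP.toℕ-fromℕ< k<7)
                (≡.sym (code-injective i j e (fromℕ< k<7)))))

-- Specialisation of the Laurent polynomials

module Values {s} {L : ℤ → LPoly} (somos : Somos5Laurent s L) where
  open Somos5Laurent somos

  L-somos5 : ∀ n → (L (n ℤ.+ + 5) *L L n) ≋ ((L (n ℤ.+ + 4) *L L (n ℤ.+ + 1)) +L (L (n ℤ.+ + 3) *L L (n ℤ.+ + 2)))
  L-somos5 n = ≈L⇒≋ (recur n)

  eval-initial : ∀ v i → eval v (L (s ℤ.+ + toℕ i)) ≡ lookup v i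
  eval-initial v i = ≡.trans (eval-≋ v {L (s ℤ.+ + toℕ i)} {var i} (≈L⇒≋ (initial i))) (eval-var v i)

  eval-somos5 : ∀ {v} → NonZeroVec v → ∀ n →
    eval v (L (n ℤ.+ + 5)) ℚ.* eval v (L n) ≡
    eval v (L (n ℤ.+ + 4)) ℚ.* eval v (L (n ℤ.+ + 1)) ℚ.+ eval v (L (n ℤ.+ + 3)) ℚ.* eval v (L (n ℤ.+ + 2))
  eval-somos5 {v} v≢0 n = begin
    eval v L₅ ℚ.* eval v L₀                                   ≡⟨ eval-*L v≢0 L₅ L₀ ⟨
    eval v (L₅ *L L₀)                                         ≡⟨ eval-≋ v (L-somos5 n) ⟩
    eval v ((L₄ *L L₁) +L (L₃ *L L₂))                         ≡⟨ eval-+L v (L₄ *L L₁) (L₃ *L L₂) ⟩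
    eval v (L₄ *L L₁) ℚ.+ eval v (L₃ *L L₂)                   ≡⟨ cong₂ ℚ._+_ (eval-*L v≢0 L₄ L₁) (eval-*L v≢0 L₃ L₂) ⟩
    eval v L₄ ℚ.* eval v L₁ ℚ.+ eval v L₃ ℚ.* eval v L₂       ∎
    where
    open ≡.≡-Reasoning
    L₀ = L n
    L₁ = L (n ℤ.+ + 1)
    L₂ = L (n ℤ.+ + 2)
    L₃ = L (n ℤ.+ + 3)
    L₄ = L (n ℤ.+ + 4)
    L₅ = L (n ℤ.+ + 5)

  private
    ones : Vec ℚ 5
    ones = replicate 5 1ℚ

    ones≢0 : NonZeroVec ones
    ones≢0 = ℚP.1≢0 ∷ ℚP.1≢0 ∷ ℚP.1≢0 ∷ ℚP.1≢0 ∷ ℚP.1≢0 ∷ []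

    c : ℤ → ℚ
    c n = eval ones (L n)

    Pos : ℤ → Set
    Pos n = 0ℚ ℚ.< c n

    pos-* : ∀ {x y} → 0ℚ ℚ.< x → 0ℚ ℚ.< y → 0ℚ ℚ.< x ℚ.* y
    pos-* {x} {y} 0<x 0<y = subst (ℚ._< x ℚ.* y) (ℚP.*-zeroʳ x) (ℚP.*-monoʳ-<-pos x {{ℚ.positive 0<x}} 0<y)

    pos-cancel : ∀ {x y z} → x ℚ.* y ≡ z → 0ℚ ℚ.< y → 0ℚ ℚ.< z → 0ℚ ℚ.< x
    pos-cancel {x} {y} refl 0<y 0<z =
      ℚP.*-cancelʳ-<-nonNeg y {{ℚP.pos⇒nonNeg y {{ℚ.positive 0<y}}}} (subst (ℚ._< x ℚ.* y) (≡.sym (ℚP.*-zeroˡ y)) 0<z)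

    pos-sum : ∀ {x y z w} → 0ℚ ℚ.< x → 0ℚ ℚ.< y → 0ℚ ℚ.< z → 0ℚ ℚ.< w → 0ℚ ℚ.< x ℚ.* y ℚ.+ z ℚ.* w
    pos-sum 0<x 0<y 0<z 0<w = ℚP.+-mono-< (pos-* 0<x 0<y) (pos-* 0<z 0<w)

    -- Somos-5 is free of subtraction, so positivity of five consecutive values passes to the next
    -- one.
    pos-up : ∀ n → Run Pos n 5 → Run Pos (n ℤ.+ + 1) 5
    pos-up n r = run-up r (pos-cancel (eval-somos5 ones≢0 n)
      (subst Pos (ℤP.+-identityʳ n) (run-at r 0)) (pos-sum (run-at r 4) (run-at r 1) (run-at r 3) (run-at r 2)))

    pos-down : ∀ n → Run Pos (n ℤ.+ + 1) 5 → Run Pos n 5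
    pos-down n r = run-down r (pos-cancel (≡.trans (ℚP.*-comm (c n) (c (n ℤ.+ + 5))) (eval-somos5 ones≢0 n))
      (run-tail n r 4) (pos-sum (run-tail n r 3) (run-tail n r 0) (run-tail n r 2) (run-tail n r 1)))

    pos-start : Run Pos s 5
    pos-start = mkRun λ k k<5 → subst (λ k → Pos (s ℤ.+ + k)) (FinP.toℕ-fromℕ< k<5)
      (subst (0ℚ ℚ.<_) (≡.sym (≡.trans (eval-initial ones (fromℕ< k<5)) (VecP.lookup-replicate (fromℕ< k<5) 1ℚ)))
        (ℚP.positive⁻¹ 1ℚ))

  L≉0 : ∀ n → ¬ (L n ≋ [])
  L≉0 n Ln≋0 = ℚP.<-irrefl (≡.sym (eval-≋ ones Ln≋0))
    (subst Pos (ℤP.+-identityʳ n) (run-at (ℤ-induction-from (λ n → Run Pos n 5) s pos-start pos-up pos-down n) 0))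

  open Somos7 laurentSemiring

  L-cancel : ∀ n P Q → (L n *L P) ≋ (L n *L Q) → P ≋ Q
  L-cancel n P Q = *L-cancelˡ (L n) P Q (L≉0 n)

  -- The base index is 0 for either kind of data, whatever `s` is: `D` is then the product of the
  -- terms with indices 1 to 4, which specialise to units in both cases.
  D N : LPoly
  D = denAt L L-somos5 L-cancel (+ 0)
  N = numAt L L-somos5 L-cancel (+ 0)

  eval-somos57 : ∀ {v} → NonZeroVec v → Somos57 (eval v D) (eval v N) (λ n → eval v (L n))
  eval-somos57 {v} v≢0 = record { somos5 = eval-somos5 v≢0 ; somos7 = λ n → begin
    eval v D ℚ.* (eval v (L (n ℤ.+ + 7)) ℚ.* eval v (L n) ℚ.+ eval v (L (n ℤ.+ + 5)) ℚ.* eval v (L (n ℤ.+ + 2)))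
      ≡⟨ cong (eval v D ℚ.*_) (cong₂ ℚ._+_ (eval-*L v≢0 (L (n ℤ.+ + 7)) (L n)) (eval-*L v≢0 (L (n ℤ.+ + 5)) (L (n ℤ.+ + 2)))) ⟨
    eval v D ℚ.* (eval v (L (n ℤ.+ + 7) *L L n) ℚ.+ eval v (L (n ℤ.+ + 5) *L L (n ℤ.+ + 2)))
      ≡⟨ cong (eval v D ℚ.*_) (eval-+L v (L (n ℤ.+ + 7) *L L n) (L (n ℤ.+ + 5) *L L (n ℤ.+ + 2))) ⟨
    eval v D ℚ.* eval v ((L (n ℤ.+ + 7) *L L n) +L (L (n ℤ.+ + 5) *L L (n ℤ.+ + 2)))
      ≡⟨ eval-*L v≢0 D ((L (n ℤ.+ + 7) *L L n) +L (L (n ℤ.+ + 5) *L L (n ℤ.+ + 2))) ⟨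
    eval v (D *L ((L (n ℤ.+ + 7) *L L n) +L (L (n ℤ.+ + 5) *L L (n ℤ.+ + 2))))
      ≡⟨ eval-≋ v (somos7 L L-somos5 L-cancel n) ⟩
    eval v (N *L (L (n ℤ.+ + 4) *L L (n ℤ.+ + 3)))
      ≡⟨ eval-*L v≢0 N (L (n ℤ.+ + 4) *L L (n ℤ.+ + 3)) ⟩
    eval v N ℚ.* eval v (L (n ℤ.+ + 4) *L L (n ℤ.+ + 3))
      ≡⟨ cong (eval v N ℚ.*_) (eval-*L v≢0 (L (n ℤ.+ + 4)) (L (n ℤ.+ + 3))) ⟩
    eval v N ℚ.* (eval v (L (n ℤ.+ + 4)) ℚ.* eval v (L (n ℤ.+ + 3))) ∎ }
    where open ≡.≡-Reasoning

-- Well-balanced initial data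

module _ (p : ℕ) (pr : Prime p) where
  open PAdic p pr

  -- The common form of the two kinds of data. Both outer terms appear because the numerator of K
  -- contains both.
  record Balanced (a : ℤ → ℚ) : Set where
    field
      int₀  : Int (a (+ 0))
      int₅  : Int (a (+ 5))
      unit₁ : PUnit p (a (+ 1))
      unit₂ : PUnit p (a (+ 2))
      unit₃ : PUnit p (a (+ 3))
      unit₄ : PUnit p (a (+ 4))

  unit-Int : ∀ {x} → PUnit p x → Int x
  unit-Int u = mkInt (proj₂ u)

  unit-¬Div : ∀ {x} → PUnit p x → ¬ Div x
  unit-¬Div u d = proj₁ u (div d)

  unit-≢0 : ∀ {x} → PUnit p x → x ≢ 0ℚ
  unit-≢0 u refl = proj₁ u (p ∣0)

  -- Applied with `x` and `y` the two outer terms τ₀ and τ₅ and `z` equal to τ₄τ₁ + τ₃τ₂: the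
  -- well-balanced inequality becomes integrality of the outer term that is not prescribed.
  quotient-Int : ∀ {x y z} → x ℚ.* y ≡ z → y ≢ 0ℚ → AbsLe p z y → Int x
  quotient-Int {x} {y} refl y≢0 z≤y = subst Int (begin
    x ℚ.* y ℚ.* inv y       ≡⟨ ℚP.*-assoc x y (inv y) ⟩
    x ℚ.* (y ℚ.* inv y)     ≡⟨ cong (x ℚ.*_) (ℚP.*-comm y (inv y)) ⟩
    x ℚ.* (inv y ℚ.* y)     ≡⟨ cong (x ℚ.*_) (inv-inverseˡ y≢0) ⟩
    x ℚ.* 1ℚ                ≡⟨ ℚP.*-identityʳ x ⟩
    x                       ∎) (mkInt z≤y)
    where open ≡.≡-Reasoning

  module _ {s} {L : ℤ → LPoly} (somos : Somos5Laurent s L) {v} (v≢0 : NonZeroVec v)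
    (balanced : Balanced (λ n → eval v (L n))) where
    open Values somos
    open Balanced balanced

    private
      a : ℤ → ℚ
      a n = eval v (L n)

      Int-+L : ∀ {P Q} → Int (eval v P) → Int (eval v Q) → Int (eval v (P +L Q))
      Int-+L {P} {Q} iP iQ = subst Int (≡.sym (eval-+L v P Q)) (Int-+ {eval v P} {eval v Q} iP iQ)

      Int-*L : ∀ {P Q} → Int (eval v P) → Int (eval v Q) → Int (eval v (P *L Q))
      Int-*L {P} {Q} iP iQ = subst Int (≡.sym (eval-*L v≢0 P Q)) (Int-* {eval v P} {eval v Q} iP iQ)

      ¬Div-*L : ∀ {P Q} → Int (eval v P) → Int (eval v Q) → ¬ Div (eval v P) → ¬ Div (eval v Q) → ¬ Div (eval v (P *L Q))
      ¬Div-*L {P} {Q} iP iQ ¬dP ¬dQ d =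
        ¬Div-* {eval v P} {eval v Q} iP iQ ¬dP ¬dQ (subst Div (eval-*L v≢0 P Q) d)

      i₁ = unit-Int {a (+ 1)} unit₁
      i₂ = unit-Int {a (+ 2)} unit₂
      i₃ = unit-Int {a (+ 3)} unit₃
      i₄ = unit-Int {a (+ 4)} unit₄
      u₁ = unit-¬Div {a (+ 1)} unit₁
      u₂ = unit-¬Div {a (+ 2)} unit₂
      u₃ = unit-¬Div {a (+ 3)} unit₃
      u₄ = unit-¬Div {a (+ 4)} unit₄

      product₄-Int : ∀ {P Q R S} → Int (eval v P) → Int (eval v Q) → Int (eval v R) → Int (eval v S) →
        Int (eval v (((P *L Q) *L R) *L S))
      product₄-Int {P} {Q} {R} {S} iP iQ iR iS =
        Int-*L {(P *L Q) *L R} {S} (Int-*L {P *L Q} {R} (Int-*L {P} {Q} iP iQ) iR) iS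

      l : ℕ → LPoly
      l k = L (+ k)

      D-Int : Int (eval v D)
      D-Int = product₄-Int {l 1} {l 2} {l 3} {l 4} i₁ i₂ i₃ i₄

      D-unit : ¬ Div (eval v D)
      D-unit = ¬Div-*L {(l 1 *L l 2) *L l 3} {l 4} (Int-*L {l 1 *L l 2} {l 3} (Int-*L {l 1} {l 2} i₁ i₂) i₃) i₄
        (¬Div-*L {l 1 *L l 2} {l 3} (Int-*L {l 1} {l 2} i₁ i₂) i₃ (¬Div-*L {l 1} {l 2} i₁ i₂ u₁ u₂) u₃) u₄

      N-Int : Int (eval v N)
      N-Int = Int-+L {((m₁ +L m₂) +L m₃) +L m₄} {D +L D} (Int-+L {(m₁ +L m₂) +L m₃} {m₄}
        (Int-+L {m₁ +L m₂} {m₃} (Int-+L {m₁} {m₂}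
        (product₄-Int {l 3} {l 3} {l 0} {l 4} i₃ i₃ int₀ i₄) (product₄-Int {l 4} {l 4} {l 1} {l 1} i₄ i₄ i₁ i₁))
        (product₄-Int {l 5} {l 2} {l 2} {l 1} int₅ i₂ i₂ i₁)) (product₄-Int {l 3} {l 3} {l 2} {l 2} i₃ i₃ i₂ i₂))
        (Int-+L {D} {D} D-Int D-Int)
        where
        m₁ = ((l 3 *L l 3) *L l 0) *L l 4
        m₂ = ((l 4 *L l 4) *L l 1) *L l 1
        m₃ = ((l 5 *L l 2) *L l 2) *L l 1
        m₄ = ((l 3 *L l 3) *L l 2) *L l 2

      module R = Reduction p pr (eval v D) (eval v N) D-Int D-unit N-Int

      relation₆ : a (+ 6) ℚ.* a (+ 1) ≡ a (+ 5) ℚ.* a (+ 2) ℚ.+ a (+ 4) ℚ.* a (+ 3)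
      relation₆ = eval-somos5 v≢0 (+ 1)

      int₆ : Int (a (+ 6))
      int₆ = Int-cancel {a (+ 1)} {a (+ 6)} u₁ i₁ (subst Int (≡.sym (≡.trans (ℚP.*-comm (a (+ 1)) (a (+ 6))) relation₆))
        (Int-+ {a (+ 5) ℚ.* a (+ 2)} {a (+ 4) ℚ.* a (+ 3)}
          (Int-* {a (+ 5)} {a (+ 2)} int₅ i₂) (Int-* {a (+ 4)} {a (+ 3)} i₄ i₃)))

      -- Among the terms 0 to 6 this is the only pair at distance at most two without one of the
      -- units τ₁, ..., τ₄. If `p` divided both, it would divide the product τ₄τ₃ of units.
      apart₅₆ : ¬ (Div (a (+ 5)) × Div (a (+ 6)))
      apart₅₆ (d₅ , d₆) = R.apart-step {a (+ 6)} {a (+ 1)} {a (+ 5)} {a (+ 2)} {a (+ 4)} {a (+ 3)} relation₆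
        i₁ i₂ i₄ i₃ (λ d → u₄ (proj₂ d)) (λ d → u₃ (proj₂ d)) (d₆ , d₅)

      start : R.Window (eval-somos57 v≢0) (+ 0)
      start = record
        { integral = mkRun λ { 0 _ → int₀ ; 1 _ → i₁ ; 2 _ → i₂ ; 3 _ → i₃ ; 4 _ → i₄ ; 5 _ → int₅ ; 6 _ → int₆
                             ; (suc (suc (suc (suc (suc (suc (suc k))))))) k< → contradiction k< (ℕP.m+n≮m 7 k) }
        ; apart₁ = mkRun λ { 0 _ d → u₁ (proj₂ d) ; 1 _ d → u₁ (proj₁ d) ; 2 _ d → u₂ (proj₁ d) ; 3 _ d → u₃ (proj₁ d)
                           ; 4 _ d → u₄ (proj₁ d) ; 5 _ d → apart₅₆ d
                           ; (suc (suc (suc (suc (suc (suc k)))))) k< → contradiction k< (ℕP.m+n≮m 6 k) }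
        ; apart₂ = mkRun λ { 0 _ d → u₂ (proj₂ d) ; 1 _ d → u₁ (proj₁ d) ; 2 _ d → u₂ (proj₁ d) ; 3 _ d → u₃ (proj₁ d)
                           ; 4 _ d → u₄ (proj₁ d)
                           ; (suc (suc (suc (suc (suc k))))) k< → contradiction k< (ℕP.m+n≮m 5 k) }
        }

    conclusion : ((n : ℤ) → PInt p (eval v (L n))) ×
      Σ ℕ (λ M → (M ≥ 1) × ((n : ℤ) → CongModP p (eval v (L (n ℤ.+ + M))) (eval v (L n))))
    conclusion = (λ n → pint (R.terms-integral (eval-somos57 v≢0) start n)) ,
      Prod.map₂ (Prod.map₂ (λ period n → div (period n))) (R.periodic (eval-somos57 v≢0) start)

theorem2p6 : (p : ℕ) → Prime p → (s : Start) → (v : Vec ℚ 5) → WellBalanced p s v →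
    (L : ℤ → LPoly) → Somos5Laurent (startIdx s) L →
    ((n : ℤ) → PInt p (eval v (L n))) ×
    Σ ℕ (λ N → (N ≥ 1) × ((n : ℤ) → CongModP p (eval v (L (n ℤ.+ + N))) (eval v (L n))))
theorem2p6 p pr start0 v@(t₀ ∷ t₁ ∷ t₂ ∷ t₃ ∷ t₄ ∷ []) (u₁ , u₂ , u₃ , u₄ , t₀≢0 , small , t₀-int) L somos =
  conclusion p pr somos v≢0 record
    { int₀ = PAdic.mkInt (subst (PInt p) (≡.sym (given (# 0))) t₀-int)
    ; int₅ = quotient-Int p pr {eval v (L (+ 5))} (eval-somos5 v≢0 (+ 0)) (subst (_≢ 0ℚ) (≡.sym (given (# 0))) t₀≢0)
        (≡.subst₂ (AbsLe p)
          (≡.sym (cong₂ ℚ._+_ (cong₂ ℚ._*_ (given (# 4)) (given (# 1))) (cong₂ ℚ._*_ (given (# 3)) (given (# 2)))))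
          (≡.sym (given (# 0))) small)
    ; unit₁ = subst (PUnit p) (≡.sym (given (# 1))) u₁
    ; unit₂ = subst (PUnit p) (≡.sym (given (# 2))) u₂
    ; unit₃ = subst (PUnit p) (≡.sym (given (# 3))) u₃
    ; unit₄ = subst (PUnit p) (≡.sym (given (# 4))) u₄
    }
  where
  open Values somos
  given = eval-initial v
  v≢0 : NonZeroVec v
  v≢0 = t₀≢0 ∷ unit-≢0 p pr u₁ ∷ unit-≢0 p pr u₂ ∷ unit-≢0 p pr u₃ ∷ unit-≢0 p pr u₄ ∷ []
theorem2p6 p pr start1 v@(t₁ ∷ t₂ ∷ t₃ ∷ t₄ ∷ t₅ ∷ []) (u₁ , u₂ , u₃ , u₄ , t₅≢0 , small , t₅-int) L somos =
  conclusion p pr somos v≢0 record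
    -- Position `i` of `v` now carries index `i + 1`, so `given (# 4)` concerns τ₅, and the outer
    -- term to be recovered is τ₀.
    { int₀ = quotient-Int p pr {eval v (L (+ 0))}
        (≡.trans (ℚP.*-comm (eval v (L (+ 0))) (eval v (L (+ 5)))) (eval-somos5 v≢0 (+ 0)))
        (subst (_≢ 0ℚ) (≡.sym (given (# 4))) t₅≢0)
        (≡.subst₂ (AbsLe p)
          (≡.sym (cong₂ ℚ._+_ (cong₂ ℚ._*_ (given (# 3)) (given (# 0))) (cong₂ ℚ._*_ (given (# 2)) (given (# 1)))))
          (≡.sym (given (# 4))) small)
    ; int₅ = PAdic.mkInt (subst (PInt p) (≡.sym (given (# 4))) t₅-int)
    ; unit₁ = subst (PUnit p) (≡.sym (given (# 0))) u₁
    ; unit₂ = subst (PUnit p) (≡.sym (given (# 1))) u₂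
    ; unit₃ = subst (PUnit p) (≡.sym (given (# 2))) u₃
    ; unit₄ = subst (PUnit p) (≡.sym (given (# 3))) u₄
    }
  where
  open Values somos
  given = eval-initial v
  v≢0 : NonZeroVec v
  v≢0 = unit-≢0 p pr u₁ ∷ unit-≢0 p pr u₂ ∷ unit-≢0 p pr u₃ ∷ unit-≢0 p pr u₄ ∷ t₅≢0 ∷ []
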